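{- Let $d\ge 1$ and let $\mathbf{s}=(s_1,\ldots,s_d)$ be a strictly increasing sequence of positive integers. Then $\mathbf{P}_d^{(\mathbf{s})}$ is Gorenstein of index $2$ if and only if $\mathbf{s}=\left(\frac{t_1}{2},\frac{t_2}{2},\ldots,\frac{t_d}{2}\right)$ for some sequence of positive integers $\mathbf{t}=(t_1,\ldots,t_d)$ such that $\mathbf{P}_d^{(\mathbf{t})}$ is reflexive up to translation. Moreover, there is no strictly increasing sequence $\mathbf{s}$ of positive integers such that $\mathbf{P}_d^{(\mathbf{s})}$ is Gorenstein of index $c$ with $c\ge 3$.
   Context: For a sequence of positive integers $\mathbf{s}=(s_1,\ldots,s_d)$, the $\mathbf{s}$-lecture hall polytope is $\mathbf{P}_d^{(\mathbf{s})}=\{\mathbf{x}\in\mathbb{R}^d : 0\le \frac{x_1}{s_1}\le\frac{x_2}{s_2}\le\cdots\le\frac{x_d}{s_d}\le 1\}$, a $d$-dimensional lattice polytope. A $d$-dimensional lattice polytope $\mathcal{P}\subset\mathbb{R}^d$ is Fano if $(\mathcal{P}\setminus\partial\mathcal{P})\cap\mathbb{Z}^d=\{\mathbf{0}\}$. It is reflexive if it is Fano and its dual polytope $\mathcal{P}^\vee=\{y\in\mathbb{R}^d : \langle x,y\rangle\le 1 \text{ for all } x\in\mathcal{P}\}$ is a lattice polytope. "Reflexive up to translation" means that some translate by a vector in $\mathbb{Z}^d$ is reflexive. Two $d$-dimensional lattice polytopes $\mathcal{P},\mathcal{Q}\subset\mathbb{R}^d$ are unimodularly equivalent if $\mathcal{Q}=f_U(\mathcal{P})+\mathbf{w}$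 for some $U\in\mathbb{Z}^{d\times d}$ with $\det U=\pm1$ and some $\mathbf{w}\in\mathbb{Z}^d$, where $f_U(\mathbf{v})=\mathbf{v}U$. For $c\in\mathbb{Z}_{>0}$, $\mathcal{P}$ is Gorenstein of index $c$ if $c\mathcal{P}=\{c\alpha:\alpha\in\mathcal{P}\}$ is unimodularly equivalent to a reflexive polytope. -}

module Defs where

open import Level using (Level) renaming (suc to lsuc)
open import Algebra.Apartness.Structures using (IsHeytingField)
open import Algebra.Bundles using (CommutativeRing)
open import Algebra.Core using (Op₁; Op₂)
import Algebra.Definitions.RawMonoid as RawMonoidOps
import Algebra.Properties.CommutativeMonoid.Sum as CommutativeMonoidSum
import Algebra.Properties.Ring as RingProperties
open import Data.Fin as Fin using (Fin; zero; suc; toℕ; fromℕ; inject₁; punchIn)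
open import Data.Integer as ℤ using (ℤ; +_; -[1+_]; 0ℤ; 1ℤ; -1ℤ)
open import Data.Integer.Properties as ℤₚ using ()
open import Data.Nat as ℕ using (ℕ; zero; suc; NonZero)
open import Data.Product using (Σ; ∃; ∃-syntax; _×_; _,_; proj₁)
open import Data.Sum using (_⊎_; inj₁; inj₂)
open import Data.Vec.Functional using (Vector)
open import Function.Bundles using (_⇔_)
open import Relation.Binary.Core using (Rel)
open import Relation.Binary.PropositionalEquality using (_≡_)
open import Relation.Binary.Structures using (IsStrictPartialOrder)
open import Relation.Nullary using (¬_)
open import Relation.Unary using (Pred; _∈_; _≐_)

------------------------------------------------------------------------
-- The real numbers
--
-- The standard library has no reals, so they enter through their
-- axioms: a Cauchy-complete Archimedean ordered field.  Classically
-- these axioms determine ℝ up to isomorphism.  Totality of the order is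
-- not required; its constructive substitute is the cotransitivity of
-- apartness contained in `isHeytingField`.

record OrderedField (ℓ : Level) : Set (lsuc ℓ) where
  infix  8 -_
  infixl 7 _*_
  infixl 6 _+_
  infix  4 _≈_ _<_ _≤_ _#_
  field
    Carrier : Set ℓ
    _≈_     : Rel Carrier ℓ
    _<_     : Rel Carrier ℓ
    _+_     : Op₂ Carrier
    _*_     : Op₂ Carrier
    -_      : Op₁ Carrier
    0#      : Carrier
    1#      : Carrier

  _#_ : Rel Carrier ℓ
  x # y = x < y ⊎ y < x

  _≤_ : Rel Carrier ℓ
  x ≤ y = ¬ (y < x)

  field
    isHeytingField       : IsHeytingField _≈_ _#_ _+_ _*_ -_ 0# 1#
    isStrictPartialOrder : IsStrictPartialOrder _≈_ _<_
    +-monoˡ-<            : ∀ z {x y} → x < y → x + z < y + z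
    *-pos                : ∀ {x y} → 0# < x → 0# < y → 0# < x * y

  open IsHeytingField isHeytingField public
  open IsStrictPartialOrder isStrictPartialOrder public
    using (<-resp-≈; <-respʳ-≈; <-respˡ-≈)
    renaming (irrefl to <-irrefl; trans to <-trans; asym to <-asym)

  commutativeRing : CommutativeRing ℓ ℓ
  commutativeRing = record { isCommutativeRing = isCommutativeRing }

  open CommutativeRing commutativeRing public
    using (ring; +-rawMonoid; +-commutativeMonoid)

  open RawMonoidOps +-rawMonoid public using () renaming (_×_ to _·_)

  fromℕ# : ℕ → Carrier
  fromℕ# n = n · 1#

  fromℤ# : ℤ → Carrier
  fromℤ# (+ n)    = fromℕ# n
  fromℤ# -[1+ n ] = - fromℕ# (suc n)

  -- ∣ x - y ∣ < ε
  Close : Carrier → Carrier → Carrier → Set ℓ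
  Close ε x y = x - y < ε × y - x < ε

  0<1 : 0# < 1#
  0<1 with invertible⇒# (1# , 1*[1-0]≈1 , trans (*-comm _ _) 1*[1-0]≈1)
    where
    open RingProperties ring using (-0#≈0#)
    1*[1-0]≈1 : 1# * (1# - 0#) ≈ 1#
    1*[1-0]≈1 = trans (*-identityˡ _) (trans (+-congˡ -0#≈0#) (+-identityʳ 1#))
  ... | inj₂ 0<1 = 0<1
  ... | inj₁ 1<0 = <-respʳ-≈ -1*-1≈1 (*-pos 0<-1 0<-1)
    where
    open RingProperties ring using (-1*x≈-x; -‿involutive)
    0<-1 : 0# < - 1#
    0<-1 = <-respˡ-≈ (-‿inverseʳ 1#) (<-respʳ-≈ (+-identityˡ _) (+-monoˡ-< (- 1#) 1<0))
    -1*-1≈1 : - 1# * - 1# ≈ 1#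
    -1*-1≈1 = trans (-1*x≈-x (- 1#)) (-‿involutive 1#)

  0<fromℕ#-suc : ∀ n → 0# < fromℕ# (suc n)
  0<fromℕ#-suc zero    = <-respʳ-≈ (sym (+-identityʳ 1#)) 0<1
  0<fromℕ#-suc (suc n) = <-trans (0<fromℕ#-suc n)
    (<-respˡ-≈ (+-identityˡ _) (+-monoˡ-< (fromℕ# (suc n)) 0<1))

  1/ : ∀ n → .{{_ : NonZero n}} → Carrier
  1/ (suc n) = proj₁ (#⇒invertible (inj₂ (0<fromℕ#-suc n)))

  infixl 7 _÷_
  _÷_ : Carrier → ∀ n → .{{_ : NonZero n}} → Carrier
  x ÷ n = x * 1/ n

record RealNumbers (ℓ : Level) : Set (lsuc ℓ) where
  field
    orderedField : OrderedField ℓ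

  open OrderedField orderedField public

  field
    archimedean : ∀ x → ∃[ n ] x < fromℕ# n
    complete    : (f : ℕ → Carrier) →
                  (∀ ε → 0# < ε → ∃[ N ] ∀ m n → N ℕ.≤ m → N ℕ.≤ n → Close ε (f m) (f n)) →
                  ∃[ l ] (∀ ε → 0# < ε → ∃[ N ] ∀ n → N ℕ.≤ n → Close ε (f n) l)

------------------------------------------------------------------------
-- Integer matrices

Matrix : ℕ → Set
Matrix d = Fin d → Fin d → ℤ

open CommutativeMonoidSum ℤₚ.+-0-commutativeMonoid using () renaming (sum to ∑ℤ)

-- Laplace expansion along the first row.
det : ∀ {d} → Matrix d → ℤ
det {zero}  U = 1ℤ
det {suc d} U = ∑ℤ λ j →
  (-1ℤ ℤ.^ toℕ j) ℤ.* U zero j ℤ.* det (λ i k → U (suc i) (punchIn j k))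

------------------------------------------------------------------------
-- Integer sequences

Positive : ∀ {d} → Vector ℕ d → Set
Positive s = ∀ i → NonZero (s i)

StrictlyIncreasing : ∀ {d} → Vector ℕ d → Set
StrictlyIncreasing s = ∀ i j → i Fin.< j → s i ℕ.< s j

------------------------------------------------------------------------
-- Polytopes in K^d, as predicates on coordinate vectors

module Polytopes {ℓ} (K : OrderedField ℓ) where

  open OrderedField K hiding (zero)
  open CommutativeMonoidSum +-commutativeMonoid public using () renaming (sum to ∑)

  Point : ℕ → Set ℓ
  Point d = Vector Carrier d

  Subset : ℕ → Set (lsuc ℓ)
  Subset d = Pred (Point d) ℓ

  infix 4 _≋_
  _≋_ : ∀ {d} → Point d → Point d → Set ℓ
  x ≋ y = ∀ i → x i ≈ y i

  embed : ∀ {d} → Vector ℤ d → Point d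
  embed z i = fromℤ# (z i)

  ⟨_,_⟩ : ∀ {d} → Point d → Point d → Carrier
  ⟨ x , y ⟩ = ∑ λ i → x i * y i

  combination : ∀ {d k} → Vector Carrier k → (Fin k → Point d) → Point d
  combination a p i = ∑ λ j → a j * p j i

  ConvexHull : ∀ {d k} → (Fin k → Point d) → Subset d
  ConvexHull p x = ∃[ a ] (∀ j → 0# ≤ a j) × ∑ a ≈ 1# × x ≋ combination a p

  AffineHull : ∀ {d} → Subset d → Subset d
  AffineHull {d} P x =
    Σ ℕ λ k → Σ (Fin k → Point d) λ p → Σ (Vector Carrier k) λ a →
      (∀ j → p j ∈ P) × ∑ a ≈ 1# × x ≋ combination a p

  FullDimensional : ∀ {d} → Subset d → Set ℓ
  FullDimensional P = ∀ x → x ∈ AffineHull P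

  LatticePolytope : ∀ {d} → Subset d → Set ℓ
  LatticePolytope {d} P =
    Σ ℕ λ k → Σ (Fin k → Vector ℤ d) λ v → P ≐ ConvexHull (λ j → embed (v j))

  -- The topological interior P ∖ ∂P, for the sup-norm topology.
  Interior : ∀ {d} → Subset d → Subset d
  Interior P x = ∃[ ε ] 0# < ε × (∀ y → (∀ i → Close ε (y i) (x i)) → y ∈ P)

  Dual : ∀ {d} → Subset d → Subset d
  Dual P y = ∀ x → x ∈ P → ⟨ x , y ⟩ ≤ 1#

  Fano : ∀ {d} → Subset d → Set ℓ
  Fano P = LatticePolytope P × FullDimensional P ×
           (∀ z → embed z ∈ Interior P ⇔ (∀ i → z i ≡ 0ℤ))

  Reflexive : ∀ {d} → Subset d → Set ℓ
  Reflexive P = Fano P × LatticePolytope (Dual P)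

  translate : ∀ {d} → Subset d → Vector ℤ d → Subset d
  translate P w y = ∃[ x ] x ∈ P × y ≋ (λ i → x i + embed w i)

  ReflexiveUpToTranslation : ∀ {d} → Subset d → Set ℓ
  ReflexiveUpToTranslation P = ∃[ w ] Reflexive (translate P w)

  -- The row vector v times U.
  f[_] : ∀ {d} → Matrix d → Point d → Point d
  f[ U ] v j = ∑ λ i → v i * fromℤ# (U i j)

  image : ∀ {d} → (Point d → Point d) → Subset d → Subset d
  image f P y = ∃[ x ] x ∈ P × y ≋ f x

  UnimodularlyEquivalent : ∀ {d} → Subset d → Subset d → Set ℓ
  UnimodularlyEquivalent {d} P Q =
    Σ (Matrix d) λ U → Σ (Vector ℤ d) λ w →
      (det U ≡ 1ℤ ⊎ det U ≡ -1ℤ) × Q ≐ translate (image f[ U ] P) w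

  dilate : ∀ {d} → ℕ → Subset d → Subset d
  dilate c = image λ x i → fromℕ# c * x i

  Gorenstein : ∀ {d} → ℕ → Subset d → Set (lsuc ℓ)
  Gorenstein {d} c P =
    NonZero c × Σ (Subset d) λ Q → Reflexive Q × UnimodularlyEquivalent (dilate c P) Q

  LectureHall : ∀ {n} (s : Vector ℕ (suc n)) → Positive s → Subset (suc n)
  LectureHall {n} s s⁺ x =
    0# ≤ x/s zero ×
    (∀ (i : Fin n) → x/s (inject₁ i) ≤ x/s (suc i)) ×
    x/s (fromℕ n) ≤ 1#
    where
    x/s : Vector Carrier (suc n)
    x/s i = _÷_ (x i) (s i) {{s⁺ i}}

{-# OPTIONS --safe #-}

-- Pulling back along the inverse of a unimodular matrix U, which the adjugate identity makes
-- integral, shows that P is Gorenstein of index c exactly when cP is reflexive up to translation.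
-- Since c P^(s) = P^(cs), this settles index 2.  If c ≥ 3 then, s being strictly increasing, both
-- (c s_i - 1)_i and (c s_i - 2)_i are interior lattice points of P^(cs), whereas a translate of a
-- Fano polytope has only one.

module Submission where

open import Defs
open import Algebra.Bundles using (CommutativeRing)
import Algebra.Properties.CommutativeMonoid.Sum as CommutativeMonoidSum
import Algebra.Properties.Monoid.Mult as MonoidMult
import Algebra.Properties.Ring as RingProperties
import Algebra.Properties.Semiring.Mult as SemiringMult
import Algebra.Properties.Semiring.Sum as SemiringSum
import Algebra.Solver.Ring as RingSolver
open import Algebra.Solver.Ring.AlmostCommutativeRing
  using (AlmostCommutativeRing; fromCommutativeRing; _-Raw-AlmostCommutative⟶_)
open import Data.Fin using (Fin; zero; suc; toℕ; fromℕ; inject₁; punchIn; punchOut) renaming (_<_ to _<ᶠ_)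
open import Data.Fin.Properties
  using (punchIn-injective; punchInᵢ≢i; punchIn-punchOut; suc-injective; _≟_; any?; toℕ-inject₁; toℕ-injective; <-cmp)
open import Data.Integer as ℤ using (ℤ; -[1+_]; 0ℤ; 1ℤ; -1ℤ)
import Data.Integer.Properties as ℤₚ
open import Data.Integer.Solver using (module +-*-Solver)
import Data.Maybe as Maybe
open import Data.Nat as ℕ using (ℕ; zero; suc; NonZero)
import Data.Nat.Properties as ℕₚ
open import Data.Product using (Σ; ∃-syntax; _×_; _,_; proj₁; proj₂; swap)
open import Data.Sum using (_⊎_; inj₁; inj₂)
open import Data.Vec.Functional using (Vector; insertAt)
open import Data.Vec.Functional.Properties using (insertAt-lookup; insertAt-punchIn)
open import Function using (_∘_; _⇔_; mk⇔; Equivalence)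
open import Level using (Level)
open import Relation.Binary.Definitions using (tri<; tri≈; tri>)
open import Relation.Binary.PropositionalEquality as ≡ using (_≡_; _≢_; module ≡-Reasoning)
open import Relation.Nullary using (¬_; yes; no; contradiction)
open import Relation.Nullary.Decidable using (¬?; decidable-stable; dec⇒maybe)
open import Relation.Unary using (_∈_; _≐_)

-- `det` expands along the first row, so what is easily proved about it concerns columns: linearity
-- in each column and vanishing on equal columns. Cramer's construction then inverts `U` on one side
-- only, while transfer of polytopes needs both `f[ U ]` after `f[ V ]` and `f[ V ]` after `f[ U ]`.
-- In place of a second theory for rows, a linear dependence among d + 1 integer vectors in
-- dimension d shows that `U` kills no nonzero integer row, and this makes the inverse two-sided.
--
-- Subsets are arbitrary predicates and need not respect `≋`. Lattice polytopes do, because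
-- membership in a convex hull does, and the transfer lemmas draw on this.
--
-- The points t - k are interior because (t_i - k) / t_i = 1 - k / t_i lies strictly between 0 and 1
-- for 0 < k < t_i and grows strictly with t_i. For t = c s with c ≥ 3 every t_i exceeds 2, which
-- admits both k = 1 and k = 2. The order of the field is not assumed total, so the estimates around
-- these points are made with `<` and weakened to `≤` only at the end.

-- Finite sums in a commutative ring

module RingSums {c ℓ} (R : CommutativeRing c ℓ) where
  open CommutativeRing R hiding (zero)
  open CommutativeMonoidSum +-commutativeMonoid public using (sum-remove; ∑-comm; ∑-distrib-+)
  open CommutativeMonoidSum +-commutativeMonoid
    using (sum-replicate-zero) renaming (sum to ∑; sum-cong-≋ to sum-cong)
  open SemiringSum semiring public using (*-distribˡ-sum; *-distribʳ-sum)
  open import Relation.Binary.Reasoning.Setoid setoid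

  sum-zero : ∀ {n} (f : Vector Carrier n) → (∀ i → f i ≈ 0#) → ∑ f ≈ 0#
  sum-zero {n} f f≈0 = trans (sum-cong f≈0) (sum-replicate-zero n)

  sum-single : ∀ {n} (f : Vector Carrier n) i → (∀ j → j ≢ i → f j ≈ 0#) → ∑ f ≈ f i
  sum-single {suc n} f i f≈0 = begin
    ∑ f                       ≈⟨ sum-remove {i = i} f ⟩
    f i + ∑ (f ∘ punchIn i)   ≈⟨ +-congˡ (sum-zero _ λ j → f≈0 _ (punchInᵢ≢i i j)) ⟩
    f i + 0#                  ≈⟨ +-identityʳ _ ⟩
    f i                       ∎

  -- The identity (xA)y = x(Ay). It serves for products of integer matrices, for linear maps applied
  -- to combinations, and for adjointness of the pairing.
  sum-assoc : ∀ {m n} (x : Vector Carrier m) (A : Fin m → Fin n → Carrier) (y : Vector Carrier n) →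
              ∑ (λ j → ∑ (λ i → x i * A i j) * y j) ≈ ∑ (λ i → x i * ∑ (λ j → A i j * y j))
  sum-assoc x A y = begin
    ∑ (λ j → ∑ (λ i → x i * A i j) * y j)      ≈⟨ sum-cong (λ j → *-distribʳ-sum (y j) (λ i → x i * A i j)) ⟩
    ∑ (λ j → ∑ (λ i → x i * A i j * y j))      ≈⟨ ∑-comm (λ j i → x i * A i j * y j) ⟩
    ∑ (λ i → ∑ (λ j → x i * A i j * y j))      ≈⟨ sum-cong (λ i → sum-cong λ j → *-assoc (x i) (A i j) (y j)) ⟩
    ∑ (λ i → ∑ (λ j → x i * (A i j * y j)))    ≈⟨ sum-cong (λ i → *-distribˡ-sum (x i) (λ j → A i j * y j)) ⟨
    ∑ (λ i → x i * ∑ (λ j → A i j * y j))      ∎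

  -- `E` is kept abstract because it stands both for `δ` over the integers and for the image of `δ`
  -- under `fromℤ#`.
  sum-identityʳ : ∀ {n} (x : Vector Carrier n) (E : Fin n → Fin n → Carrier) →
                  (∀ i → E i i ≈ 1#) → (∀ i j → i ≢ j → E i j ≈ 0#) →
                  ∀ j → ∑ (λ i → x i * E i j) ≈ x j
  sum-identityʳ x E diag off j = begin
    ∑ (λ i → x i * E i j)  ≈⟨ sum-single _ j (λ i i≢j → trans (*-congˡ (off i j i≢j)) (zeroʳ _)) ⟩
    x j * E j j            ≈⟨ *-congˡ (diag j) ⟩
    x j * 1#               ≈⟨ *-identityʳ _ ⟩
    x j                    ∎

  sum-linear : ∀ {n} a b (f g : Vector Carrier n) →
               ∑ (λ i → a * f i + b * g i) ≈ a * ∑ f + b * ∑ g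
  sum-linear a b f g = begin
    ∑ (λ i → a * f i + b * g i)                ≈⟨ ∑-distrib-+ (λ i → a * f i) (λ i → b * g i) ⟩
    ∑ (λ i → a * f i) + ∑ (λ i → b * g i)      ≈⟨ +-cong (*-distribˡ-sum a f) (*-distribˡ-sum b g) ⟨
    a * ∑ f + b * ∑ g                          ∎

-- Determinants as alternating multilinear functions of the columns

module IntegerMatrices where
  open import Data.Integer using (_+_; _*_; -_; _-_; _^_)
  open CommutativeMonoidSum ℤₚ.+-0-commutativeMonoid using (sum-cong-≗) renaming (sum to ∑ℤ)
  open RingSums ℤₚ.+-*-commutativeRing
  open ≡ using (refl; sym; trans; cong; cong₂; subst)
  open ≡-Reasoning
  open +-*-Solver

  Col : ℕ → Set
  Col d = Vector ℤ d

  minor : ∀ {d} → Matrix (suc d) → Fin (suc d) → Matrix d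
  minor U j i k = U (suc i) (punchIn j k)

  det-cong : ∀ {d} {U V : Matrix d} → (∀ i j → U i j ≡ V i j) → det U ≡ det V
  det-cong {zero}  U≗V = refl
  det-cong {suc d} U≗V = sum-cong-≗ λ j →
    cong₂ _*_ (cong (-1ℤ ^ toℕ j *_) (U≗V zero j)) (det-cong λ i k → U≗V (suc i) (punchIn j k))

  AgreeOff : ∀ {d} → Fin d → Matrix d → Matrix d → Set
  AgreeOff k U V = ∀ i j → j ≢ k → U i j ≡ V i j

  -- In the term that deletes column k the three minors agree and linearity sits in the first-row
  -- entry; in every other term it sits in the minor. Relating three matrices by hypotheses, instead
  -- of replacing a column, lets the induction pass to minors directly.
  det-linear : ∀ {d} k a b (U V W : Matrix d) → AgreeOff k W U → AgreeOff k W V →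
               (∀ i → W i k ≡ a * U i k + b * V i k) → det W ≡ a * det U + b * det V
  det-linear {suc d} k a b U V W W~U W~V Wₖ = trans (sum-cong-≗ term)
    (sum-linear a b (λ j → (-1ℤ ^ toℕ j) * U zero j * det (minor U j)) (λ j → (-1ℤ ^ toℕ j) * V zero j * det (minor V j)))
    where
    term : ∀ j → (-1ℤ ^ toℕ j) * W zero j * det (minor W j) ≡
      a * ((-1ℤ ^ toℕ j) * U zero j * det (minor U j)) + b * ((-1ℤ ^ toℕ j) * V zero j * det (minor V j))
    term j with j ≟ k
    ... | yes refl = begin
      s * W zero j * det (minor W j)
        ≡⟨ cong₂ (λ x y → s * x * y) (Wₖ zero) refl ⟩
      s * (a * U zero j + b * V zero j) * det (minor W j)
        ≡⟨ solve 6 (λ s a b u v m → s :* (a :* u :+ b :* v) :* m :=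
             a :* (s :* u :* m) :+ b :* (s :* v :* m)) refl s a b (U zero j) (V zero j) (det (minor W j)) ⟩
      a * (s * U zero j * det (minor W j)) + b * (s * V zero j * det (minor W j))
        ≡⟨ cong₂ (λ x y → a * (s * U zero j * x) + b * (s * V zero j * y))
             (det-cong λ i l → W~U (suc i) _ (punchInᵢ≢i j l))
             (det-cong λ i l → W~V (suc i) _ (punchInᵢ≢i j l)) ⟩
      a * (s * U zero j * det (minor U j)) + b * (s * V zero j * det (minor V j)) ∎
      where s = -1ℤ ^ toℕ j
    ... | no j≢k = begin
      s * W zero j * det (minor W j)
        ≡⟨ cong (s * W zero j *_) (det-linear k′ a b _ _ _ (off W~U) (off W~V)
             λ i → subst (λ l → W (suc i) l ≡ a * U (suc i) l + b * V (suc i) l) (sym k′-eq) (Wₖ (suc i))) ⟩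
      s * W zero j * (a * det (minor U j) + b * det (minor V j))
        ≡⟨ solve 6 (λ s a b w m n → s :* w :* (a :* m :+ b :* n) :=
             a :* (s :* w :* m) :+ b :* (s :* w :* n)) refl s a b (W zero j) (det (minor U j)) (det (minor V j)) ⟩
      a * (s * W zero j * det (minor U j)) + b * (s * W zero j * det (minor V j))
        ≡⟨ cong₂ (λ x y → a * (s * x * det (minor U j)) + b * (s * y * det (minor V j)))
             (W~U zero j j≢k) (W~V zero j j≢k) ⟩
      a * (s * U zero j * det (minor U j)) + b * (s * V zero j * det (minor V j)) ∎
      where
      s = -1ℤ ^ toℕ j
      k′ = punchOut j≢k
      k′-eq : punchIn j k′ ≡ k
      k′-eq = punchIn-punchOut j≢k
      off : ∀ {U} → AgreeOff k W U → AgreeOff k′ (minor W j) (minor U j)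
      off W~U i l l≢k′ = W~U (suc i) _ λ eq → l≢k′ (punchIn-injective j l k′ (trans eq (sym k′-eq)))

  sum-adjacent-cancel : ∀ {n} (f : Vector ℤ (suc n)) k → f (inject₁ k) + f (suc k) ≡ 0ℤ →
                        (∀ j → j ≢ inject₁ k → j ≢ suc k → f j ≡ 0ℤ) → ∑ℤ f ≡ 0ℤ
  sum-adjacent-cancel f zero f+f≡0 f≡0 = begin
    f zero + (f (suc zero) + ∑ℤ rest)  ≡⟨ ℤₚ.+-assoc (f zero) (f (suc zero)) (∑ℤ rest) ⟨
    f zero + f (suc zero) + ∑ℤ rest    ≡⟨ cong₂ _+_ f+f≡0 (sum-zero rest λ i → f≡0 (suc (suc i)) (λ ()) (λ ())) ⟩
    0ℤ                                 ∎
    where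
    rest : Vector ℤ _
    rest i = f (suc (suc i))
  sum-adjacent-cancel f (suc k) f+f≡0 f≡0 = cong₂ _+_ (f≡0 zero (λ ()) (λ ()))
    (sum-adjacent-cancel (f ∘ suc) k f+f≡0 λ j j≢ j≢′ →
      f≡0 (suc j) (j≢ ∘ suc-injective) (j≢′ ∘ suc-injective))

  -- Neighbouring columns stay neighbours when a third column is deleted, so `det-adjacent` can
  -- recurse into that minor.
  adjacent-punchOut : ∀ {n} (j : Fin (suc (suc n))) (k : Fin (suc n)) → j ≢ inject₁ k → j ≢ suc k →
    ∃[ l ] punchIn j (inject₁ l) ≡ inject₁ k × punchIn j (suc l) ≡ suc k
  adjacent-punchOut zero          zero    j≢ _   = contradiction refl j≢
  adjacent-punchOut zero          (suc k) _  _   = k , refl , refl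
  adjacent-punchOut (suc zero)    zero    _  j≢′ = contradiction refl j≢′
  adjacent-punchOut {suc n} (suc (suc j)) zero _ _ = zero , refl , refl
  adjacent-punchOut {suc n} (suc j) (suc k) j≢ j≢′
    with adjacent-punchOut j k (j≢ ∘ cong suc) (j≢′ ∘ cong suc)
  ... | l , p , q = suc l , cong suc p , cong suc q

  -- Deleting one or the other of two neighbours gives lists that differ in a single place, where
  -- each keeps the neighbour deleted by the other. For equal columns the two minors therefore
  -- coincide.
  punchIn-adjacent : ∀ {n} (k : Fin (suc n)) j →
    punchIn (inject₁ k) j ≡ punchIn (suc k) j ⊎
    (punchIn (inject₁ k) j ≡ suc k × punchIn (suc k) j ≡ inject₁ k)
  punchIn-adjacent zero    zero    = inj₂ (refl , refl)
  punchIn-adjacent zero    (suc j) = inj₁ refl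
  punchIn-adjacent (suc k) zero    = inj₁ refl
  punchIn-adjacent {suc n} (suc k) (suc j) with punchIn-adjacent k j
  ... | inj₁ p       = inj₁ (cong suc p)
  ... | inj₂ (p , q) = inj₂ (cong suc p , cong suc q)

  -- Minors containing both equal columns vanish by induction. The two remaining terms have equal
  -- minors and entries but opposite signs.
  det-adjacent : ∀ {d} (U : Matrix (suc d)) k → (∀ i → U i (inject₁ k) ≡ U i (suc k)) → det U ≡ 0ℤ
  det-adjacent {suc d} U k eq = sum-adjacent-cancel _ k cancel vanish
    where
    minors : ∀ i j → minor U (inject₁ k) i j ≡ minor U (suc k) i j
    minors i j with punchIn-adjacent k j
    ... | inj₁ p       = cong (U (suc i)) p
    ... | inj₂ (p , q) = begin
      U (suc i) (punchIn (inject₁ k) j)  ≡⟨ cong (U (suc i)) p ⟩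
      U (suc i) (suc k)                  ≡⟨ eq (suc i) ⟨
      U (suc i) (inject₁ k)              ≡⟨ cong (U (suc i)) q ⟨
      U (suc i) (punchIn (suc k) j)      ∎
    cancel : (-1ℤ ^ toℕ (inject₁ k)) * U zero (inject₁ k) * det (minor U (inject₁ k)) +
             (-1ℤ ^ toℕ (suc k)) * U zero (suc k) * det (minor U (suc k)) ≡ 0ℤ
    cancel rewrite toℕ-inject₁ k | eq zero | det-cong minors =
      solve 3 (λ s u m → s :* u :* m :+ (con -1ℤ :* s) :* u :* m := con 0ℤ) refl
        (-1ℤ ^ toℕ k) (U zero (suc k)) (det (minor U (suc k)))
    vanish : ∀ j → j ≢ inject₁ k → j ≢ suc k → (-1ℤ ^ toℕ j) * U zero j * det (minor U j) ≡ 0ℤ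
    vanish j j≢ j≢′ with adjacent-punchOut j k j≢ j≢′
    ... | l , p , q = trans (cong ((-1ℤ ^ toℕ j) * U zero j *_) (det-adjacent (minor U j) l λ i → begin
      U (suc i) (punchIn j (inject₁ l))  ≡⟨ cong (U (suc i)) p ⟩
      U (suc i) (inject₁ k)              ≡⟨ eq (suc i) ⟩
      U (suc i) (suc k)                  ≡⟨ cong (U (suc i)) q ⟨
      U (suc i) (punchIn j (suc l))      ∎)) (ℤₚ.*-zeroʳ ((-1ℤ ^ toℕ j) * U zero j))

  setCol : ∀ {d} → Fin d → Col d → Matrix d → Matrix d
  setCol k v U i j with j ≟ k
  ... | yes _ = v i
  ... | no  _ = U i j

  setCol-same : ∀ {d} k v (U : Matrix d) i → setCol k v U i k ≡ v i
  setCol-same k v U i with k ≟ k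
  ... | yes _   = refl
  ... | no  k≢k = contradiction refl k≢k

  setCol-other : ∀ {d} k v (U : Matrix d) i j → j ≢ k → setCol k v U i j ≡ U i j
  setCol-other k v U i j j≢k with j ≟ k
  ... | yes j≡k = contradiction j≡k j≢k
  ... | no  _   = refl

  setCol-self : ∀ {d} k (U : Matrix d) i j → setCol k (λ i → U i k) U i j ≡ U i j
  setCol-self k U i j with j ≟ k
  ... | yes refl = refl
  ... | no  _    = refl

  det-setCol-linear : ∀ {d} k a b (u v : Col d) U →
    det (setCol k (λ i → a * u i + b * v i) U) ≡ a * det (setCol k u U) + b * det (setCol k v U)
  det-setCol-linear k a b u v U = det-linear k a b _ _ _ off off λ i → begin
    setCol k _ U i k                          ≡⟨ setCol-same k _ U i ⟩
    a * u i + b * v i                         ≡⟨ cong₂ (λ x y → a * x + b * y) (setCol-same k u U i) (setCol-same k v U i) ⟨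
    a * setCol k u U i k + b * setCol k v U i k ∎
    where
    off : ∀ {u v} → AgreeOff k (setCol k u U) (setCol k v U)
    off {u} {v} i j j≢k = trans (setCol-other k u U i j j≢k) (sym (setCol-other k v U i j j≢k))

  setCol-cong : ∀ {d} k {u v : Col d} U → (∀ i → u i ≡ v i) → ∀ i j → setCol k u U i j ≡ setCol k v U i j
  setCol-cong k U u≗v i j with j ≟ k
  ... | yes _ = u≗v i
  ... | no  _ = refl

  inject₁≢suc : ∀ {n} (k : Fin n) → inject₁ k ≢ suc k
  inject₁≢suc (suc k) eq = inject₁≢suc k (suc-injective eq)

  setCol-comm : ∀ {d} {k l : Fin d} u v U → k ≢ l → ∀ i j →
    setCol k u (setCol l v U) i j ≡ setCol l v (setCol k u U) i j
  setCol-comm {k = k} {l} u v U k≢l i j with j ≟ k in p | j ≟ l in q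
  ... | yes refl | yes refl = contradiction refl k≢l
  ... | yes _    | no _  rewrite p = refl
  ... | no _     | yes _ rewrite q = refl
  ... | no _     | no _  rewrite p | q = refl

  -- Polarisation: expanding the vanishing `D x+y x+y` bilinearly leaves only the two mixed terms.
  det-swap : ∀ {d} (k : Fin d) x y U →
    det (setCol (inject₁ k) x (setCol (suc k) y U)) + det (setCol (inject₁ k) y (setCol (suc k) x U)) ≡ 0ℤ
  det-swap k x y U = begin
    D x y + D y x
      ≡⟨ solve 2 (λ p q → p :+ q := con 1ℤ :* (con 1ℤ :* con 0ℤ :+ con 1ℤ :* p) :+
                    con 1ℤ :* (con 1ℤ :* q :+ con 1ℤ :* con 0ℤ)) refl (D x y) (D y x) ⟩
    1ℤ * (1ℤ * 0ℤ + 1ℤ * D x y) + 1ℤ * (1ℤ * D y x + 1ℤ * 0ℤ)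
      ≡⟨ cong₂ (λ p q → 1ℤ * (1ℤ * p + 1ℤ * D x y) + 1ℤ * (1ℤ * D y x + 1ℤ * q)) (D-diag x) (D-diag y) ⟨
    1ℤ * (1ℤ * D x x + 1ℤ * D x y) + 1ℤ * (1ℤ * D y x + 1ℤ * D y y)
      ≡⟨ cong₂ (λ p q → 1ℤ * p + 1ℤ * q) (D-linearʳ x) (D-linearʳ y) ⟨
    1ℤ * D x x+y + 1ℤ * D y x+y
      ≡⟨ det-setCol-linear (inject₁ k) 1ℤ 1ℤ x y (setCol (suc k) x+y U) ⟨
    D x+y x+y
      ≡⟨ D-diag x+y ⟩
    0ℤ ∎
    where
    x+y : Col _
    -- The factors `1ℤ` make this literally the column to which `det-setCol-linear` applies.
    x+y i = 1ℤ * x i + 1ℤ * y i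
    D : Col _ → Col _ → ℤ
    D x y = det (setCol (inject₁ k) x (setCol (suc k) y U))
    -- Linearity is available for the outermost replaced column, so the second argument of `D` is
    -- first brought outside.
    D-flip : ∀ x y → D x y ≡ det (setCol (suc k) y (setCol (inject₁ k) x U))
    D-flip x y = det-cong (setCol-comm x y U (inject₁≢suc k))
    D-linearʳ : ∀ z → D z x+y ≡ 1ℤ * D z x + 1ℤ * D z y
    D-linearʳ z = begin
      D z x+y  ≡⟨ D-flip z x+y ⟩
      det (setCol (suc k) x+y (setCol (inject₁ k) z U))
        ≡⟨ det-setCol-linear (suc k) 1ℤ 1ℤ x y (setCol (inject₁ k) z U) ⟩
      1ℤ * det (setCol (suc k) x (setCol (inject₁ k) z U)) +
      1ℤ * det (setCol (suc k) y (setCol (inject₁ k) z U))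
        ≡⟨ cong₂ (λ p q → 1ℤ * p + 1ℤ * q) (D-flip z x) (D-flip z y) ⟨
      1ℤ * D z x + 1ℤ * D z y ∎
    D-diag : ∀ x → D x x ≡ 0ℤ
    D-diag x = det-adjacent (setCol (inject₁ k) x (setCol (suc k) x U)) k λ i → begin
      setCol (inject₁ k) x (setCol (suc k) x U) i (inject₁ k)  ≡⟨ setCol-same (inject₁ k) x (setCol (suc k) x U) i ⟩
      x i                                                      ≡⟨ setCol-same (suc k) x U i ⟨
      setCol (suc k) x U i (suc k)
        ≡⟨ setCol-other (inject₁ k) x (setCol (suc k) x U) i (suc k) (inject₁≢suc k ∘ sym) ⟨
      setCol (inject₁ k) x (setCol (suc k) x U) i (suc k)      ∎

  -- Swapping the adjacent columns l - 1 and l moves the two equal columns closer together.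
  det-equal-< : ∀ {d} (U : Matrix d) m k l → toℕ l ≡ m → k <ᶠ l → (∀ i → U i k ≡ U i l) → det U ≡ 0ℤ
  det-equal-< {suc d} U (suc m) k (suc l) l≡m k<l eq with k ≟ inject₁ l
  ... | yes refl = det-adjacent U l eq
  ... | no k≢l = begin
    det U                  ≡⟨ det-cong U≗N ⟩
    N x y                  ≡⟨ ℤₚ.+-identityʳ (N x y) ⟨
    -- The recursion is on `m`, the value of the larger index, because `inject₁ l` is not
    -- structurally smaller than `suc l`.
    N x y + 0ℤ             ≡⟨ cong (N x y +_) (det-equal-< (setCol (inject₁ l) y (setCol (suc l) x U)) m k (inject₁ l) l′≡m k<l′ eq′) ⟨
    N x y + N y x          ≡⟨ det-swap l x y U ⟩
    0ℤ                     ∎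
    where
    x y : Col _
    x i = U i (inject₁ l)
    y i = U i (suc l)
    N : Col _ → Col _ → ℤ
    N x y = det (setCol (inject₁ l) x (setCol (suc l) y U))
    U≗N : ∀ i j → U i j ≡ setCol (inject₁ l) x (setCol (suc l) y U) i j
    U≗N i j with j ≟ inject₁ l
    ... | yes refl = refl
    ... | no _ = sym (setCol-self (suc l) U i j)
    l′≡m : toℕ (inject₁ l) ≡ m
    l′≡m = trans (toℕ-inject₁ l) (ℕₚ.suc-injective l≡m)
    k<l′ : k <ᶠ inject₁ l
    k<l′ = ℕₚ.≤∧≢⇒< (subst (toℕ k ℕ.≤_) (sym (toℕ-inject₁ l)) (ℕₚ.≤-pred k<l)) (k≢l ∘ toℕ-injective)
    k≢suc : k ≢ suc l
    k≢suc refl = ℕₚ.<-irrefl refl k<l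
    eq′ : ∀ i → setCol (inject₁ l) y (setCol (suc l) x U) i k ≡ setCol (inject₁ l) y (setCol (suc l) x U) i (inject₁ l)
    eq′ i = begin
      setCol (inject₁ l) y (setCol (suc l) x U) i k  ≡⟨ setCol-other (inject₁ l) y (setCol (suc l) x U) i k k≢l ⟩
      setCol (suc l) x U i k                         ≡⟨ setCol-other (suc l) x U i k k≢suc ⟩
      U i k                                          ≡⟨ eq i ⟩
      y i                                            ≡⟨ setCol-same (inject₁ l) y (setCol (suc l) x U) i ⟨
      setCol (inject₁ l) y (setCol (suc l) x U) i (inject₁ l) ∎

  det-equal : ∀ {d} (U : Matrix d) {k l} → k ≢ l → (∀ i → U i k ≡ U i l) → det U ≡ 0ℤ
  det-equal U {k} {l} k≢l eq with <-cmp k l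
  ... | tri< k<l _ _ = det-equal-< U (toℕ l) k l refl k<l eq
  ... | tri≈ _ k≡l _ = contradiction k≡l k≢l
  ... | tri> _ _ l<k = det-equal-< U (toℕ k) l k refl l<k (sym ∘ eq)

  -- Recursion, in contrast to a test for equality, makes the minor of `δ` at `zero` definitionally
  -- `δ` again.
  δ : ∀ {d} → Matrix d
  δ zero    zero    = 1ℤ
  δ zero    (suc j) = 0ℤ
  δ (suc i) zero    = 0ℤ
  δ (suc i) (suc j) = δ i j

  δ-diag : ∀ {d} (i : Fin d) → δ i i ≡ 1ℤ
  δ-diag zero    = refl
  δ-diag (suc i) = δ-diag i

  δ-off : ∀ {d} (i j : Fin d) → i ≢ j → δ i j ≡ 0ℤ
  δ-off zero    zero    i≢j = contradiction refl i≢j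
  δ-off zero    (suc j) i≢j = refl
  δ-off (suc i) zero    i≢j = refl
  δ-off (suc i) (suc j) i≢j = δ-off i j (i≢j ∘ cong suc)

  δ-comm : ∀ {d} (i j : Fin d) → δ i j ≡ δ j i
  δ-comm zero    zero    = refl
  δ-comm zero    (suc j) = refl
  δ-comm (suc i) zero    = refl
  δ-comm (suc i) (suc j) = δ-comm i j

  det-δ : ∀ d → det (δ {d}) ≡ 1ℤ
  det-δ zero    = refl
  det-δ (suc d) = cong₂ _+_ (trans (ℤₚ.*-identityˡ _) (det-δ d)) (sum-zero {d} (λ j → (-1ℤ ^ toℕ (suc j)) * 0ℤ * det (minor δ (suc j))) λ j →
    solve 2 (λ s m → s :* con 0ℤ :* m := con 0ℤ) refl (-1ℤ ^ toℕ (suc j)) (det (minor δ (suc j))))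

  det-setCol-sum : ∀ {d m} k (c : Vector ℤ m) (v : Fin m → Col d) U →
    det (setCol k (λ i → ∑ℤ λ j → c j * v j i) U) ≡ ∑ℤ (λ j → c j * det (setCol k (v j) U))
  det-setCol-sum {m = zero} k c v U = begin
    D (λ i → 0ℤ)                       ≡⟨⟩
    -- The zero column is written as a combination with zero coefficients, which linearity then
    -- pulls out.
    D (λ i → 0ℤ * 0ℤ + 0ℤ * 0ℤ)        ≡⟨ det-setCol-linear k 0ℤ 0ℤ (λ _ → 0ℤ) (λ _ → 0ℤ) U ⟩
    0ℤ * D (λ i → 0ℤ) + 0ℤ * D (λ i → 0ℤ) ≡⟨⟩
    0ℤ                                 ∎
    where
    D : Col _ → ℤ
    D u = det (setCol k u U)
  det-setCol-sum {m = suc m} k c v U = begin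
    D (λ i → c zero * v zero i + w i)         ≡⟨ det-cong (setCol-cong k U λ i →
                                                     cong (c zero * v zero i +_) (sym (ℤₚ.*-identityˡ (w i)))) ⟩
    D (λ i → c zero * v zero i + 1ℤ * w i)    ≡⟨ det-setCol-linear k (c zero) 1ℤ (v zero) w U ⟩
    c zero * D (v zero) + 1ℤ * D w            ≡⟨ cong (c zero * D (v zero) +_) (ℤₚ.*-identityˡ (D w)) ⟩
    c zero * D (v zero) + D w                 ≡⟨ cong (c zero * D (v zero) +_) (det-setCol-sum k (c ∘ suc) (v ∘ suc) U) ⟩
    ∑ℤ (λ j → c j * D (v j))                  ∎
    where
    D : Col _ → ℤ
    D u = det (setCol k u U)
    w : Col _
    w i = ∑ℤ λ j → c (suc j) * v (suc j) i

  -- Adjugate and one-sided inverse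

  -- Cofactors in Cramer's form: column k of `U` gives way to the i-th unit vector, which avoids
  -- signs and row deletions.
  adjugate : ∀ {d} → Matrix d → Matrix d
  adjugate U k i = det (setCol k (δ i) U)

  -- Linearity in column k gathers the sum into the determinant of `U` with column k replaced by
  -- column j. That matrix is `U` itself if j = k, and otherwise has two equal columns.
  adjugate-left : ∀ {d} (U : Matrix d) k j → ∑ℤ (λ i → adjugate U k i * U i j) ≡ det U * δ k j
  adjugate-left U k j = begin
    ∑ℤ (λ i → adjugate U k i * U i j)
      ≡⟨ sum-cong-≗ (λ i → ℤₚ.*-comm (adjugate U k i) (U i j)) ⟩
    ∑ℤ (λ i → U i j * adjugate U k i)
      ≡⟨ det-setCol-sum k (λ i → U i j) δ U ⟨
    det (setCol k (λ l → ∑ℤ λ i → U i j * δ i l) U)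
      ≡⟨ det-cong (setCol-cong k U (sum-identityʳ (λ i → U i j) δ δ-diag δ-off)) ⟩
    det (setCol k (λ l → U l j) U)
      ≡⟨ replaced ⟩
    det U * δ k j ∎
    where
    replaced : det (setCol k (λ l → U l j) U) ≡ det U * δ k j
    replaced with k ≟ j
    ... | yes refl = begin
      det (setCol k (λ l → U l k) U)  ≡⟨ det-cong (setCol-self k U) ⟩
      det U                           ≡⟨ ℤₚ.*-identityʳ (det U) ⟨
      det U * 1ℤ                      ≡⟨ cong (det U *_) (δ-diag k) ⟨
      det U * δ k k                   ∎
    ... | no k≢j = begin
      det (setCol k (λ l → U l j) U)  ≡⟨ det-equal _ k≢j (λ i → trans (setCol-same k _ U i)
                                           (sym (setCol-other k _ U i j (k≢j ∘ sym)))) ⟩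
      0ℤ                              ≡⟨ ℤₚ.*-zeroʳ (det U) ⟨
      det U * 0ℤ                      ≡⟨ cong (det U *_) (δ-off k j k≢j) ⟨
      det U * δ k j                   ∎

  infixl 7 _⊡_
  _⊡_ : ∀ {d} → Matrix d → Matrix d → Matrix d
  (U ⊡ V) i j = ∑ℤ λ k → U i k * V k j

  infix 4 _≗₂_
  _≗₂_ : ∀ {d} → Matrix d → Matrix d → Set
  U ≗₂ V = ∀ i j → U i j ≡ V i j

  unimodular⇒left-inverse : ∀ {d} (U : Matrix d) → det U ≡ 1ℤ ⊎ det U ≡ -1ℤ → ∃[ V ] V ⊡ U ≗₂ δ
  -- Since `det U` is 1 or -1, it is its own inverse, and multiplying by it replaces division.
  unimodular⇒left-inverse U detU = (λ k i → det U * adjugate U k i) , λ k j → begin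
    ∑ℤ (λ i → det U * adjugate U k i * U i j)
      ≡⟨ sum-cong-≗ (λ i → ℤₚ.*-assoc (det U) (adjugate U k i) (U i j)) ⟩
    ∑ℤ (λ i → det U * (adjugate U k i * U i j))
      ≡⟨ *-distribˡ-sum (det U) (λ i → adjugate U k i * U i j) ⟨
    det U * ∑ℤ (λ i → adjugate U k i * U i j)
      ≡⟨ cong (det U *_) (adjugate-left U k j) ⟩
    det U * (det U * δ k j)
      ≡⟨ ℤₚ.*-assoc (det U) (det U) (δ k j) ⟨
    det U * det U * δ k j
      ≡⟨ cong (_* δ k j) (square detU) ⟩
    1ℤ * δ k j
      ≡⟨ ℤₚ.*-identityˡ (δ k j) ⟩
    δ k j ∎
    where
    square : det U ≡ 1ℤ ⊎ det U ≡ -1ℤ → det U * det U ≡ 1ℤ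
    square (inj₁ eq) rewrite eq = refl
    square (inj₂ eq) rewrite eq = refl

  -- Linear dependence over the integers and two-sided inverses

  -- Gaussian elimination without fractions. If all first coordinates vanish, `p zero` gets
  -- coefficient 0 and the rest is induction. Otherwise a nonzero pivot π clears the first
  -- coordinate of the other vectors after these are multiplied by π. A dependency b of the results
  -- lifts to b π on those vectors, with the subtracted multiples of the pivot vector collected in
  -- its coefficient - c. It stays nontrivial because the integers have no zero divisors.
  dependent : ∀ m (p : Fin (suc m) → Vector ℤ m) →
    Σ (Vector ℤ (suc m)) λ a → (∃[ j ] a j ≢ 0ℤ) × (∀ i → ∑ℤ (λ j → a j * p j i) ≡ 0ℤ)
  dependent zero    p = (λ _ → 1ℤ) , (zero , λ ()) , λ ()
  dependent (suc m) p with any? (λ j → ¬? (p j zero ℤ.≟ 0ℤ))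
  ... | no allzero with dependent m (λ j i → p (suc j) (suc i))
  ...   | a , (j , aⱼ≢0) , comb = insertAt a zero 0ℤ , (suc j , aⱼ≢0) , comb′
    where
    comb′ : ∀ i → ∑ℤ (λ j → insertAt a zero 0ℤ j * p j i) ≡ 0ℤ
    comb′ zero    = sum-zero _ λ j → trans
      (cong (insertAt a zero 0ℤ j *_) (decidable-stable (p j zero ℤ.≟ 0ℤ) (allzero ∘ (j ,_))))
      (ℤₚ.*-zeroʳ (insertAt a zero 0ℤ j))
    comb′ (suc i) = trans (ℤₚ.+-identityˡ _) (comb i)
  dependent (suc m) p | yes (j₀ , π≢0) with dependent m
    (λ j i → p j₀ zero * p (punchIn j₀ j) (suc i) - p (punchIn j₀ j) zero * p j₀ (suc i))
  ... | b , (j₁ , bⱼ≢0) , comb = a , (punchIn j₀ j₁ , a≢0) , comb′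
    where
    π = p j₀ zero
    r : Fin (suc m) → Vector ℤ (suc m)
    r j = p (punchIn j₀ j)
    c = ∑ℤ λ j → b j * r j zero
    a : Vector ℤ (suc (suc m))
    a = insertAt (λ j → b j * π) j₀ (- c)
    a≢0 : a (punchIn j₀ j₁) ≢ 0ℤ
    a≢0 eq with ℤₚ.i*j≡0⇒i≡0∨j≡0 (b j₁) (trans (sym (insertAt-punchIn (λ j → b j * π) j₀ (- c) j₁)) eq)
    ... | inj₁ b≡0 = bⱼ≢0 b≡0
    ... | inj₂ π≡0 = π≢0 π≡0
    expand : ∀ i → ∑ℤ (λ j → a j * p j i) ≡ ∑ℤ (λ j → b j * (π * r j i - r j zero * p j₀ i))
    expand i = begin
      ∑ℤ (λ j → a j * p j i)
        ≡⟨ sum-remove {i = j₀} (λ j → a j * p j i) ⟩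
      a j₀ * p j₀ i + ∑ℤ (λ j → a (punchIn j₀ j) * r j i)
        ≡⟨ cong₂ (λ x y → x * p j₀ i + y) (insertAt-lookup (λ j → b j * π) j₀ (- c))
             (sum-cong-≗ λ j → cong (_* r j i) (insertAt-punchIn (λ j → b j * π) j₀ (- c) j)) ⟩
      - c * p j₀ i + ∑ℤ (λ j → b j * π * r j i)
        ≡⟨ cong₂ _+_ (solve 2 (λ c x → :- c :* x := (:- x) :* c) refl c (p j₀ i))
             (trans (sum-cong-≗ λ j → solve 3 (λ x y z → x :* y :* z := y :* (x :* z)) refl (b j) π (r j i))
                    (sym (*-distribˡ-sum π (λ j → b j * r j i)))) ⟩
      - p j₀ i * c + π * ∑ℤ (λ j → b j * r j i)
        ≡⟨ sum-linear (- p j₀ i) π (λ j → b j * r j zero) (λ j → b j * r j i) ⟨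
      ∑ℤ (λ j → - p j₀ i * (b j * r j zero) + π * (b j * r j i))
        ≡⟨ sum-cong-≗ (λ j → solve 5 (λ x b u π v → :- x :* (b :* u) :+ π :* (b :* v) :=
              b :* (π :* v :- u :* x)) refl (p j₀ i) (b j) (r j zero) π (r j i)) ⟩
      ∑ℤ (λ j → b j * (π * r j i - r j zero * p j₀ i)) ∎
    comb′ : ∀ i → ∑ℤ (λ j → a j * p j i) ≡ 0ℤ
    comb′ zero    = trans (expand zero) (sum-zero _ λ j →
      solve 3 (λ b π u → b :* (π :* u :- u :* π) := con 0ℤ) refl (b j) π (r j zero))
    comb′ (suc i) = trans (expand (suc i)) (comb i)

  -- A dependency between x and the rows of V is carried by U to one between 0 and the unit vectors.
  left-inverse⇒injective : ∀ {d} (U V : Matrix d) → V ⊡ U ≗₂ δ →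
    ∀ x → (∀ j → ∑ℤ (λ i → x i * U i j) ≡ 0ℤ) → ∀ i → x i ≡ 0ℤ
  left-inverse⇒injective {d} U V VU≗δ x xU≡0 i with dependent d p
    where
    p : Fin (suc d) → Vector ℤ d
    p zero    = x
    p (suc k) = V k
  ... | a , (j₀ , aⱼ≢0) , comb = conclude
    where
    vanish : ∀ k → a (suc k) ≡ 0ℤ
    vanish k = begin
      a (suc k)
        ≡⟨ sum-identityʳ (a ∘ suc) δ δ-diag δ-off k ⟨
      ∑ℤ (λ l → a (suc l) * δ l k)
        ≡⟨ sum-cong-≗ (λ l → cong (a (suc l) *_) (VU≗δ l k)) ⟨
      ∑ℤ (λ l → a (suc l) * ∑ℤ (λ i → V l i * U i k))
        ≡⟨ sum-assoc (a ∘ suc) V (λ i → U i k) ⟨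
      ∑ℤ (λ i → ∑ℤ (λ l → a (suc l) * V l i) * U i k)
        ≡⟨ ℤₚ.+-identityˡ _ ⟨
      0ℤ + ∑ℤ (λ i → ∑ℤ (λ l → a (suc l) * V l i) * U i k)
        ≡⟨ cong (_+ ∑ℤ (λ i → ∑ℤ (λ l → a (suc l) * V l i) * U i k))
             (trans (cong (a zero *_) (xU≡0 k)) (ℤₚ.*-zeroʳ (a zero))) ⟨
      a zero * ∑ℤ (λ i → x i * U i k) + ∑ℤ (λ i → ∑ℤ (λ l → a (suc l) * V l i) * U i k)
        ≡⟨ cong (_+ ∑ℤ (λ i → ∑ℤ (λ l → a (suc l) * V l i) * U i k))
             (trans (*-distribˡ-sum (a zero) (λ i → x i * U i k))
             (sum-cong-≗ λ i → sym (ℤₚ.*-assoc (a zero) (x i) (U i k)))) ⟩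
      ∑ℤ (λ i → a zero * x i * U i k) + ∑ℤ (λ i → ∑ℤ (λ l → a (suc l) * V l i) * U i k)
        ≡⟨ ∑-distrib-+ (λ i → a zero * x i * U i k) _ ⟨
      ∑ℤ (λ i → a zero * x i * U i k + ∑ℤ (λ l → a (suc l) * V l i) * U i k)
        ≡⟨ sum-zero _ (λ i → trans (sym (ℤₚ.*-distribʳ-+ (U i k) (a zero * x i) _)) (cong (_* U i k) (comb i))) ⟩
      0ℤ ∎
    a₀≢0 : a zero ≢ 0ℤ
    a₀≢0 = head≢0 (j₀ , aⱼ≢0)
      where
      head≢0 : (∃[ j ] a j ≢ 0ℤ) → a zero ≢ 0ℤ
      head≢0 (zero  , a≢0) = a≢0
      head≢0 (suc k , a≢0) = contradiction (vanish k) a≢0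
    a₀xᵢ≡0 : a zero * x i ≡ 0ℤ
    a₀xᵢ≡0 = begin
      a zero * x i                                       ≡⟨ ℤₚ.+-identityʳ _ ⟨
      a zero * x i + 0ℤ                                  ≡⟨ cong (a zero * x i +_) (sum-zero _ λ k → cong (_* V k i) (vanish k)) ⟨
      a zero * x i + ∑ℤ (λ k → a (suc k) * V k i)        ≡⟨ comb i ⟩
      0ℤ                                                 ∎
    conclude : x i ≡ 0ℤ
    conclude with ℤₚ.i*j≡0⇒i≡0∨j≡0 (a zero) a₀xᵢ≡0
    ... | inj₁ a₀≡0 = contradiction a₀≡0 a₀≢0
    ... | inj₂ xᵢ≡0 = xᵢ≡0

  -- Each row of UV - 1 is killed by `U`, since (UV)U = U(VU) = U, and so vanishes by injectivity.
  left-inverse⇒right-inverse : ∀ {d} (U V : Matrix d) → V ⊡ U ≗₂ δ → U ⊡ V ≗₂ δ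
  left-inverse⇒right-inverse U V VU≗δ i j = ℤₚ.i-j≡0⇒i≡j _ _
    (left-inverse⇒injective U V VU≗δ (λ j → (U ⊡ V) i j - δ i j) rowU≡0 j)
    where
    rowU≡0 : ∀ k → ∑ℤ (λ j → ((U ⊡ V) i j - δ i j) * U j k) ≡ 0ℤ
    rowU≡0 k = begin
      ∑ℤ (λ j → ((U ⊡ V) i j - δ i j) * U j k)
        ≡⟨ sum-cong-≗ (λ j → solve 3 (λ a b c → (a :- b) :* c := con 1ℤ :* (a :* c) :+ con -1ℤ :* (b :* c)) refl
             ((U ⊡ V) i j) (δ i j) (U j k)) ⟩
      ∑ℤ (λ j → 1ℤ * ((U ⊡ V) i j * U j k) + -1ℤ * (δ i j * U j k))
        ≡⟨ sum-linear 1ℤ -1ℤ (λ j → (U ⊡ V) i j * U j k) (λ j → δ i j * U j k) ⟩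
      1ℤ * ∑ℤ (λ j → (U ⊡ V) i j * U j k) + -1ℤ * ∑ℤ (λ j → δ i j * U j k)
        ≡⟨ cong₂ (λ x y → 1ℤ * x + -1ℤ * y)
             (trans (sum-assoc (U i) V (λ j → U j k))
               (trans (sum-cong-≗ λ l → cong (U i l *_) (VU≗δ l k)) (sum-identityʳ (U i) δ δ-diag δ-off k)))
             (trans (sum-cong-≗ λ j → trans (ℤₚ.*-comm (δ i j) (U j k)) (cong (U j k *_) (δ-comm i j)))
               (sum-identityʳ (λ j → U j k) δ δ-diag δ-off i)) ⟩
      1ℤ * U i k + -1ℤ * U i k
        ≡⟨ solve 1 (λ u → con 1ℤ :* u :+ con -1ℤ :* u := con 0ℤ) refl (U i k) ⟩
      0ℤ ∎

-- The integers inside an ordered field, and its order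

module OrderedFieldProperties {ℓ : Level} (K : OrderedField ℓ) where
  open import Data.Integer using (+_)
  open OrderedField K hiding (zero)
  open CommutativeRing commutativeRing using (semiring; +-monoid)
  open RingProperties ring using (-‿involutive; -0#≈0#; -‿+-comm; -‿distribˡ-*; -‿distribʳ-*)
  open MonoidMult +-monoid using (×-homo-+)
  open SemiringMult semiring using (×1-homo-*)
  open import Relation.Binary.Reasoning.Setoid setoid

  fromℤ-⊖ : ∀ m n → fromℤ# (m ℤ.⊖ n) ≈ fromℕ# m - fromℕ# n
  fromℤ-⊖ m zero = sym (trans (+-congˡ -0#≈0#) (+-identityʳ _))
  fromℤ-⊖ zero (suc n) = sym (+-identityˡ _)
  fromℤ-⊖ (suc m) (suc n) = begin
    fromℤ# (suc m ℤ.⊖ suc n)              ≡⟨ ≡.cong fromℤ# (ℤₚ.[1+m]⊖[1+n]≡m⊖n m n) ⟩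
    fromℤ# (m ℤ.⊖ n)                      ≈⟨ fromℤ-⊖ m n ⟩
    fromℕ# m - fromℕ# n                   ≈⟨ +-congʳ (+-identityˡ _) ⟨
    0# + fromℕ# m - fromℕ# n              ≈⟨ +-congʳ (+-congʳ (-‿inverseʳ 1#)) ⟨
    1# - 1# + fromℕ# m - fromℕ# n         ≈⟨ +-congʳ (+-assoc _ _ _) ⟩
    1# + (- 1# + fromℕ# m) - fromℕ# n     ≈⟨ +-congʳ (+-congˡ (+-comm _ _)) ⟩
    1# + (fromℕ# m - 1#) - fromℕ# n       ≈⟨ +-congʳ (+-assoc _ _ _) ⟨
    fromℕ# (suc m) - 1# - fromℕ# n        ≈⟨ +-assoc _ _ _ ⟩
    fromℕ# (suc m) + (- 1# - fromℕ# n)    ≈⟨ +-congˡ (-‿+-comm _ _) ⟩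
    fromℕ# (suc m) - fromℕ# (suc n)       ∎

  fromℤ-neg : ∀ i → fromℤ# (ℤ.- i) ≈ - fromℤ# i
  fromℤ-neg (+ zero)  = sym -0#≈0#
  fromℤ-neg (+ suc n) = refl
  fromℤ-neg -[1+ n ]  = sym (-‿involutive _)

  fromℤ-+ : ∀ i j → fromℤ# (i ℤ.+ j) ≈ fromℤ# i + fromℤ# j
  fromℤ-+ (+ m)    (+ n)    = ×-homo-+ 1# m n
  fromℤ-+ (+ m)    -[1+ n ] = fromℤ-⊖ m (suc n)
  fromℤ-+ -[1+ m ] (+ n)    = trans (fromℤ-⊖ n (suc m)) (+-comm _ _)
  fromℤ-+ -[1+ m ] -[1+ n ] = begin
    - fromℕ# (suc (suc (m ℕ.+ n)))        ≡⟨ ≡.cong (λ k → - fromℕ# (suc k)) (ℕₚ.+-suc m n) ⟨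
    - fromℕ# (suc m ℕ.+ suc n)            ≈⟨ -‿cong (×-homo-+ 1# (suc m) (suc n)) ⟩
    - (fromℕ# (suc m) + fromℕ# (suc n))   ≈⟨ -‿+-comm _ _ ⟨
    - fromℕ# (suc m) - fromℕ# (suc n)     ∎

  fromℕ-* : ∀ m n → fromℕ# (m ℕ.* n) ≈ fromℕ# m * fromℕ# n
  fromℕ-* = ×1-homo-*

  fromℤ-*-pos : ∀ m j → fromℤ# (+ m ℤ.* j) ≈ fromℕ# m * fromℤ# j
  fromℤ-*-pos m (+ n) = begin
    fromℤ# (+ m ℤ.* + n)    ≡⟨ ≡.cong fromℤ# (ℤₚ.pos-* m n) ⟨
    fromℕ# (m ℕ.* n)        ≈⟨ fromℕ-* m n ⟩
    fromℕ# m * fromℕ# n     ∎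
  fromℤ-*-pos m -[1+ n ] = begin
    fromℤ# (+ m ℤ.* ℤ.- + suc n)      ≡⟨ ≡.cong fromℤ# (ℤₚ.neg-distribʳ-* (+ m) (+ suc n)) ⟨
    fromℤ# (ℤ.- (+ m ℤ.* + suc n))    ≈⟨ fromℤ-neg (+ m ℤ.* + suc n) ⟩
    - fromℤ# (+ m ℤ.* + suc n)        ≈⟨ -‿cong (fromℤ-*-pos m (+ suc n)) ⟩
    - (fromℕ# m * fromℕ# (suc n))     ≈⟨ -‿distribʳ-* _ _ ⟩
    fromℕ# m * - fromℕ# (suc n)       ∎

  fromℤ-* : ∀ i j → fromℤ# (i ℤ.* j) ≈ fromℤ# i * fromℤ# j
  fromℤ-* (+ m)    j = fromℤ-*-pos m j
  fromℤ-* -[1+ m ] j = begin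
    fromℤ# ((ℤ.- + suc m) ℤ.* j)      ≡⟨ ≡.cong fromℤ# (ℤₚ.neg-distribˡ-* (+ suc m) j) ⟨
    fromℤ# (ℤ.- (+ suc m ℤ.* j))      ≈⟨ fromℤ-neg (+ suc m ℤ.* j) ⟩
    - fromℤ# (+ suc m ℤ.* j)          ≈⟨ -‿cong (fromℤ-*-pos (suc m) j) ⟩
    - (fromℕ# (suc m) * fromℤ# j)     ≈⟨ -‿distribˡ-* _ _ ⟩
    - fromℕ# (suc m) * fromℤ# j       ∎

  fromℤ-1 : fromℤ# 1ℤ ≈ 1#
  fromℤ-1 = +-identityʳ 1#

  almostCommutativeRing : AlmostCommutativeRing ℓ ℓ
  almostCommutativeRing = fromCommutativeRing commutativeRing

  fromℤ-morphism : CommutativeRing.rawRing ℤₚ.+-*-commutativeRing -Raw-AlmostCommutative⟶ almostCommutativeRing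
  fromℤ-morphism = record
    { ⟦_⟧ = fromℤ# ; +-homo = fromℤ-+ ; *-homo = fromℤ-* ; -‿homo = fromℤ-neg ; 0-homo = refl ; 1-homo = fromℤ-1 }

  -- Coefficients are integers because their equality is decidable, which is not assumed of the
  -- field.
  module Solver = RingSolver (CommutativeRing.rawRing ℤₚ.+-*-commutativeRing) almostCommutativeRing fromℤ-morphism
    (λ i j → Maybe.map (reflexive ∘ ≡.cong fromℤ#) (dec⇒maybe (i ℤ.≟ j)))
  open Solver using (solve; _:=_; _:+_; _:*_; _:-_; :-_; con)

  <⇒≤ : ∀ {x y} → x < y → x ≤ y
  <⇒≤ x<y y<x = <-asym x<y y<x

  ≤-resp-≈ : ∀ {x x′ y y′} → x ≈ x′ → y ≈ y′ → x ≤ y → x′ ≤ y′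
  ≤-resp-≈ x≈x′ y≈y′ x≤y y′<x′ = x≤y (<-respˡ-≈ (sym y≈y′) (<-respʳ-≈ (sym x≈x′) y′<x′))

  <-resp₂-≈ : ∀ {x x′ y y′} → x ≈ x′ → y ≈ y′ → x < y → x′ < y′
  <-resp₂-≈ x≈x′ y≈y′ x<y = <-respˡ-≈ x≈x′ (<-respʳ-≈ y≈y′ x<y)

  +-monoʳ-< : ∀ z {x y} → x < y → z + x < z + y
  +-monoʳ-< z x<y = <-resp₂-≈ (+-comm _ _) (+-comm _ _) (+-monoˡ-< z x<y)

  +-mono-< : ∀ {x y u v} → x < y → u < v → x + u < y + v
  +-mono-< x<y u<v = <-trans (+-monoˡ-< _ x<y) (+-monoʳ-< _ u<v)

  +-cancelʳ-< : ∀ z {x y} → x + z < y + z → x < y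
  +-cancelʳ-< z x+z<y+z = <-resp₂-≈ (cancel _) (cancel _) (+-monoˡ-< (- z) x+z<y+z)
    where
    cancel : ∀ x → x + z - z ≈ x
    cancel x = solve 2 (λ x z → x :+ z :- z := x) refl x z

  *-monoʳ-< : ∀ {z x y} → 0# < z → x < y → x * z < y * z
  *-monoʳ-< {z} {x} {y} 0<z x<y = <-resp₂-≈ (+-identityˡ _)
    (solve 3 (λ x y z → (y :- x) :* z :+ x :* z := y :* z) refl x y z)
    (+-monoˡ-< (x * z) (*-pos (<-respˡ-≈ (-‿inverseʳ x) (+-monoˡ-< (- x) x<y)) 0<z))

  fromℕ-mono-< : ∀ {m n} → m ℕ.< n → fromℕ# m < fromℕ# n
  fromℕ-mono-< {zero}  {suc n} _           = 0<fromℕ#-suc n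
  fromℕ-mono-< {suc m} {suc n} (ℕ.s≤s m<n) = +-monoʳ-< 1# (fromℕ-mono-< m<n)

  -- A strict inequality of integers has a gap of at least 1, which absorbs the error `x`. This
  -- carries inequalities at a lattice point over to nearby points.
  fromℕ-+-< : ∀ {m n x} → x < 1# → m ℕ.< n → fromℕ# m + x < fromℕ# n
  fromℕ-+-< {m} {n} {x} x<1 m<n = step (ℕₚ.m≤n⇒m<n∨m≡n m<n)
    where
    m+x<1+m : fromℕ# m + x < fromℕ# (suc m)
    m+x<1+m = <-respʳ-≈ (+-comm _ _) (+-monoʳ-< (fromℕ# m) x<1)
    step : suc m ℕ.< n ⊎ suc m ≡ n → fromℕ# m + x < fromℕ# n
    step (inj₁ 1+m<n)  = <-trans m+x<1+m (fromℕ-mono-< 1+m<n)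
    step (inj₂ ≡.refl) = m+x<1+m

  fromℕ*1/ : ∀ n .{{_ : NonZero n}} → fromℕ# n * 1/ n ≈ 1#
  fromℕ*1/ (suc n) = begin
    fromℕ# (suc n) * 1/ (suc n)        ≈⟨ *-congʳ (trans (+-congˡ -0#≈0#) (+-identityʳ _)) ⟨
    -- The Heyting field axioms speak of inverses of differences, hence the `- 0#`.
    (fromℕ# (suc n) - 0#) * 1/ (suc n) ≈⟨ proj₂ (proj₂ (#⇒invertible (inj₂ (0<fromℕ#-suc n)))) ⟩
    1#                                 ∎

  0<fromℕ : ∀ n .{{_ : NonZero n}} → 0# < fromℕ# n
  0<fromℕ (suc n) = 0<fromℕ#-suc n

  -- Without totality the sign has to come from apartness: an invertible element is apart from 0,
  -- and a negative reciprocal of n would give 1 < 0.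
  0<1/ : ∀ n .{{_ : NonZero n}} → 0# < 1/ n
  0<1/ n = case (invertible⇒# {1/ n} {0#} (fromℕ# n , left , trans (*-comm _ _) left))
    where
    left : fromℕ# n * (1/ n - 0#) ≈ 1#
    left = trans (*-congˡ (trans (+-congˡ -0#≈0#) (+-identityʳ _))) (fromℕ*1/ n)
    case : 1/ n # 0# → 0# < 1/ n
    case (inj₂ 0<1/n) = 0<1/n
    case (inj₁ 1/n<0) = contradiction 0<1 (<-asym (<-resp₂-≈ (trans (*-comm _ _) (fromℕ*1/ n)) (zeroˡ _)
      (*-monoʳ-< (0<fromℕ n) 1/n<0)))

  ÷-monoˡ-< : ∀ {x y} n .{{_ : NonZero n}} → x < y → x ÷ n < y ÷ n
  ÷-monoˡ-< n = *-monoʳ-< (0<1/ n)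

  fromℕ÷ : ∀ n .{{_ : NonZero n}} x → fromℕ# n * (x ÷ n) ≈ x
  fromℕ÷ n x = begin
    fromℕ# n * (x * 1/ n)  ≈⟨ solve 3 (λ a x b → a :* (x :* b) := x :* (a :* b)) refl (fromℕ# n) x (1/ n) ⟩
    x * (fromℕ# n * 1/ n)  ≈⟨ *-congˡ (fromℕ*1/ n) ⟩
    x * 1#                 ≈⟨ *-identityʳ x ⟩
    x                      ∎

  ÷-scale : ∀ c s t .{{_ : NonZero s}} .{{_ : NonZero t}} → c ℕ.* s ≡ t → ∀ x → (fromℕ# c * x) ÷ t ≈ x ÷ s
  ÷-scale c s t ≡.refl x = begin
    fromℕ# c * x * 1/ t                          ≈⟨ *-identityʳ _ ⟨
    fromℕ# c * x * 1/ t * 1#                     ≈⟨ *-congˡ (fromℕ*1/ s) ⟨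
    fromℕ# c * x * 1/ t * (fromℕ# s * 1/ s)
      ≈⟨ solve 5 (λ c x a s b → c :* x :* a :* (s :* b) := (c :* s) :* a :* (x :* b)) refl
           (fromℕ# c) x (1/ t) (fromℕ# s) (1/ s) ⟩
    fromℕ# c * fromℕ# s * 1/ t * (x * 1/ s)      ≈⟨ *-congʳ (*-congʳ (fromℕ-* c s)) ⟨
    fromℕ# t * 1/ t * (x * 1/ s)                 ≈⟨ *-congʳ (fromℕ*1/ t) ⟩
    1# * (x * 1/ s)                              ≈⟨ *-identityˡ _ ⟩
    x * 1/ s                                     ∎

  Close-cong : ∀ {ε x x′ y y′} → x - y ≈ x′ - y′ → Close ε x y → Close ε x′ y′
  Close-cong {x = x} {x′} {y} {y′} eq (p , q) = <-respˡ-≈ eq p , <-respˡ-≈ eq′ q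
    where
    eq′ : y - x ≈ y′ - x′
    eq′ = begin
      y - x        ≈⟨ solve 2 (λ x y → y :- x := :- (x :- y)) refl x y ⟩
      - (x - y)    ≈⟨ -‿cong eq ⟩
      - (x′ - y′)  ≈⟨ solve 2 (λ x y → y :- x := :- (x :- y)) refl x′ y′ ⟨
      y′ - x′      ∎

-- Transfer of polytope properties along unimodular maps

module LatticeTransformations {ℓ : Level} (K : OrderedField ℓ) where
  open import Data.Integer using (+_)
  open OrderedField K hiding (zero)
  open Polytopes K
  open OrderedFieldProperties K
  open Solver using (solve; _:=_; _:+_; _:*_; _:-_; :-_; con)
  open RingProperties ring using (-‿distribˡ-*; -‿distribʳ-*; -‿involutive)
  open RingSums commutativeRing
  open RingProperties ℤₚ.+-*-ring using () renaming (+-cancelʳ to ℤ-+-cancelʳ)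
  open IntegerMatrices
  open CommutativeMonoidSum +-commutativeMonoid using () renaming (sum-cong-≋ to sum-cong)
  open CommutativeMonoidSum ℤₚ.+-0-commutativeMonoid using () renaming (sum to ∑ℤ)
  open import Relation.Binary.Reasoning.Setoid setoid

  infixl 7 _⊙_
  _⊙_ : ∀ {d} → Vector ℤ d → Matrix d → Vector ℤ d
  (z ⊙ U) j = ∑ℤ λ i → z i ℤ.* U i j

  infixl 6 _⊕_
  _⊕_ : ∀ {d} → Point d → Point d → Point d
  (x ⊕ y) i = x i + y i

  -- A record lets `U` and `V` be inferred from a proof. Points are row vectors, so `left` says that
  -- `f[ U ]` undoes `f[ V ]`.
  record MutuallyInverse {d : ℕ} (U V : Matrix d) : Set where
    constructor _,_
    field
      left  : V ⊡ U ≗₂ δ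
      right : U ⊡ V ≗₂ δ

  mutuallyInverse-sym : ∀ {d} {U V : Matrix d} → MutuallyInverse U V → MutuallyInverse V U
  mutuallyInverse-sym (left , right) = right , left

  mutuallyInverse-transpose : ∀ {d} {U V : Matrix d} → MutuallyInverse U V →
                              MutuallyInverse (λ i j → V j i) (λ i j → U j i)
  mutuallyInverse-transpose {U = U} {V} (left , right) = transposed V U left , transposed U V right
    where
    open CommutativeMonoidSum ℤₚ.+-0-commutativeMonoid using (sum-cong-≗)
    transposed : ∀ U V → U ⊡ V ≗₂ δ → (λ i j → V j i) ⊡ (λ i j → U j i) ≗₂ δ
    transposed U V UV≗δ i j = ≡.trans (sum-cong-≗ λ k → ℤₚ.*-comm (V k i) (U j k))
      (≡.trans (UV≗δ j i) (δ-comm j i))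

  mutuallyInverse-δ : ∀ {d} → MutuallyInverse (δ {d}) δ
  mutuallyInverse-δ = idempotent , idempotent
    where
    open RingSums ℤₚ.+-*-commutativeRing using () renaming (sum-identityʳ to sum-identityʳ′)
    idempotent : δ ⊡ δ ≗₂ δ
    idempotent i = sum-identityʳ′ (δ i) δ δ-diag δ-off

  unimodular⇒inverse : ∀ {d} (U : Matrix d) → det U ≡ 1ℤ ⊎ det U ≡ -1ℤ → ∃[ V ] MutuallyInverse U V
  unimodular⇒inverse U detU with unimodular⇒left-inverse U detU
  ... | V , VU≗δ = V , (VU≗δ , left-inverse⇒right-inverse U V VU≗δ)

  Respects≋ : ∀ {d} → Subset d → Set ℓ
  Respects≋ P = ∀ {x y} → x ≋ y → x ∈ P → y ∈ P

  ≋-trans : ∀ {d} {x y z : Point d} → x ≋ y → y ≋ z → x ≋ z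
  ≋-trans p q i = trans (p i) (q i)

  ≋-sym : ∀ {d} {x y : Point d} → x ≋ y → y ≋ x
  ≋-sym p i = sym (p i)

  fromℤ-sum : ∀ {n} (f : Vector ℤ n) → fromℤ# (∑ℤ f) ≈ ∑ (λ i → fromℤ# (f i))
  fromℤ-sum {zero}  f = refl
  fromℤ-sum {suc n} f = trans (fromℤ-+ (f zero) (∑ℤ (f ∘ suc))) (+-congˡ (fromℤ-sum (f ∘ suc)))

  f-cong : ∀ {d} (U : Matrix d) {x y} → x ≋ y → f[ U ] x ≋ f[ U ] y
  f-cong U x≋y j = sum-cong λ i → *-congʳ (x≋y i)

  f-⊕ : ∀ {d} (U : Matrix d) x y → f[ U ] (x ⊕ y) ≋ f[ U ] x ⊕ f[ U ] y
  f-⊕ U x y j = trans (sum-cong λ i → distribʳ (fromℤ# (U i j)) (x i) (y i))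
    (∑-distrib-+ (λ i → x i * fromℤ# (U i j)) (λ i → y i * fromℤ# (U i j)))

  f-combination : ∀ {d k} (U : Matrix d) (a : Vector Carrier k) p →
                  f[ U ] (combination a p) ≋ combination a (λ j → f[ U ] (p j))
  f-combination U a p j = sum-assoc a p (λ i → fromℤ# (U i j))

  f-embed : ∀ {d} (U : Matrix d) z → f[ U ] (embed z) ≋ embed (z ⊙ U)
  f-embed U z j = sym (trans (fromℤ-sum (λ i → z i ℤ.* U i j)) (sum-cong λ i → fromℤ-* (z i) (U i j)))

  combination-cong : ∀ {d k} (a : Vector Carrier k) {p q : Fin k → Point d} →
                     (∀ j → p j ≋ q j) → combination a p ≋ combination a q
  combination-cong a p≋q i = sum-cong λ j → *-congˡ (p≋q j i)

  f-δ : ∀ {d} (x : Point d) → f[ δ ] x ≋ x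
  f-δ x = sum-identityʳ x (λ i j → fromℤ# (δ i j))
    (λ i → trans (reflexive (≡.cong fromℤ# (δ-diag i))) fromℤ-1)
    (λ i j i≢j → reflexive (≡.cong fromℤ# (δ-off i j i≢j)))

  f-inverse : ∀ {d} {U V : Matrix d} → MutuallyInverse U V → ∀ x → f[ U ] (f[ V ] x) ≋ x
  f-inverse {U = U} {V} (VU≗δ , _) x j = begin
    f[ U ] (f[ V ] x) j
      ≈⟨ sum-assoc x (λ i k → fromℤ# (V i k)) (λ k → fromℤ# (U k j)) ⟩
    ∑ (λ i → x i * ∑ (λ k → fromℤ# (V i k) * fromℤ# (U k j)))
      ≈⟨ sum-cong (λ i → *-congˡ (f-embed U (V i) j)) ⟩
    ∑ (λ i → x i * fromℤ# ((V ⊡ U) i j))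
      ≈⟨ sum-cong (λ i → *-congˡ (reflexive (≡.cong fromℤ# (VU≗δ i j)))) ⟩
    f[ δ ] x j
      ≈⟨ f-δ x j ⟩
    x j ∎

  f-adjoint : ∀ {d} (U : Matrix d) x y → ⟨ f[ U ] x , y ⟩ ≈ ⟨ x , f[ (λ i j → U j i) ] y ⟩
  f-adjoint U x y = trans (sum-assoc x (λ i j → fromℤ# (U i j)) y)
    (sum-cong λ i → *-congˡ (sum-cong λ j → *-comm (fromℤ# (U i j)) (y j)))

  ⟨⟩-congˡ : ∀ {d} {x x′ : Point d} → x ≋ x′ → ∀ y → ⟨ x , y ⟩ ≈ ⟨ x′ , y ⟩
  ⟨⟩-congˡ x≋x′ y = sum-cong λ i → *-congʳ (x≋x′ i)

  -- The summands are increased by one so that the estimates below are strict.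
  bound : ∀ {n} → Vector ℤ n → ℕ
  bound {zero}  m = 1
  bound {suc n} m = suc ℤ.∣ m zero ∣ ℕ.+ bound (m ∘ suc)

  *-fromℤ-< : ∀ {η u} m → 0# < η → u < η → - u < η → u * fromℤ# m < fromℕ# (suc ℤ.∣ m ∣) * η
  *-fromℤ-< {η} {u} (+ n) 0<η u<η _ = go n
    where
    go : ∀ n → u * fromℕ# n < fromℕ# (suc n) * η
    go zero    = <-resp₂-≈ (sym (zeroʳ u)) (sym (trans (*-congʳ (+-identityʳ 1#)) (*-identityˡ η))) 0<η
    go (suc n) = <-resp₂-≈ (sym (trans (distribˡ _ _ _) (+-congʳ (*-identityʳ u))))
      (sym (trans (distribʳ _ _ _) (+-congʳ (*-identityˡ η)))) (+-mono-< u<η (go n))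
  *-fromℤ-< {η} {u} -[1+ n ] 0<η u<η -u<η = <-respˡ-≈
    (trans (sym (-‿distribˡ-* _ _)) (-‿distribʳ-* _ _))
    (*-fromℤ-< (+ suc n) 0<η -u<η (<-respˡ-≈ (sym (-‿involutive u)) u<η))

  sum-fromℤ-< : ∀ {n η} (u : Vector Carrier n) m → 0# < η → (∀ i → u i < η) → (∀ i → - u i < η) →
                ∑ (λ i → u i * fromℤ# (m i)) < fromℕ# (bound m) * η
  sum-fromℤ-< {zero}  {η} u m 0<η _ _ = <-respʳ-≈ (sym (trans (*-congʳ (+-identityʳ 1#)) (*-identityˡ η))) 0<η
  sum-fromℤ-< {suc n} {η} u m 0<η u<η -u<η = <-respʳ-≈
    (trans (sym (distribʳ η _ _)) (*-congʳ (sym (fromℤ-+ (+ suc ℤ.∣ m zero ∣) (+ bound (m ∘ suc))))))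
    (+-mono-< (*-fromℤ-< (m zero) 0<η (u<η zero) (-u<η zero))
              (sum-fromℤ-< (u ∘ suc) (m ∘ suc) 0<η (u<η ∘ suc) (-u<η ∘ suc)))

  total : ∀ {n} → Vector ℕ n → ℕ
  total {zero}  a = 0
  total {suc n} a = a zero ℕ.+ total (a ∘ suc)

  ≤-total : ∀ {n} (a : Vector ℕ n) i → a i ℕ.≤ total a
  ≤-total a zero    = ℕₚ.m≤m+n _ _
  ≤-total a (suc i) = ℕₚ.≤-trans (≤-total (a ∘ suc) i) (ℕₚ.m≤n+m _ _)

  f-continuous : ∀ {d} (U : Matrix d) {ε} → 0# < ε → ∃[ η ] 0# < η ×
    (∀ x y → (∀ i → Close η (y i) (x i)) → ∀ j → Close ε (f[ U ] y j) (f[ U ] x j))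
  f-continuous {d} U {ε} 0<ε = ε ÷ N , 0<η , λ x y close j →
    oneSided y x (proj₁ ∘ close) (proj₂ ∘ close) j , oneSided x y (proj₂ ∘ close) (proj₁ ∘ close) j
    where
    b : Vector ℕ d
    b j = bound (λ i → U i j)
    -- The sum of the column bounds dominates each of them, so a single η serves all coordinates;
    -- `suc` makes the comparison strict.
    N = suc (total b)
    η = ε ÷ N
    0<η : 0# < η
    0<η = *-pos 0<ε (0<1/ N)
    oneSided : ∀ x y → (∀ i → x i - y i < η) → (∀ i → y i - x i < η) → ∀ j → f[ U ] x j - f[ U ] y j < ε
    oneSided x y x-y<η y-x<η j = <-trans
      (<-respˡ-≈ difference (sum-fromℤ-< (λ i → x i - y i) (λ i → U i j) 0<η x-y<η
        (λ i → <-respˡ-≈ (solve 2 (λ x y → y :- x := :- (x :- y)) refl (x i) (y i)) (y-x<η i))))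
      (<-respʳ-≈ (fromℕ÷ N ε) (*-monoʳ-< 0<η (fromℕ-mono-< (ℕ.s≤s (≤-total b j)))))
      where
      difference : ∑ (λ i → (x i - y i) * fromℤ# (U i j)) ≈ f[ U ] x j - f[ U ] y j
      difference = begin
        ∑ (λ i → (x i - y i) * fromℤ# (U i j))
          ≈⟨ sum-cong (λ i → solve 3 (λ x y u → (x :- y) :* u := con 1ℤ :* (x :* u) :+ con -1ℤ :* (y :* u)) refl
               (x i) (y i) (fromℤ# (U i j))) ⟩
        ∑ (λ i → fromℤ# 1ℤ * (x i * fromℤ# (U i j)) + fromℤ# -1ℤ * (y i * fromℤ# (U i j)))
          ≈⟨ sum-linear (fromℤ# 1ℤ) (fromℤ# -1ℤ) (λ i → x i * fromℤ# (U i j)) (λ i → y i * fromℤ# (U i j)) ⟩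
        fromℤ# 1ℤ * f[ U ] x j + fromℤ# -1ℤ * f[ U ] y j
          ≈⟨ solve 2 (λ p q → con 1ℤ :* p :+ con -1ℤ :* q := p :- q) refl (f[ U ] x j) (f[ U ] y j) ⟩
        f[ U ] x j - f[ U ] y j ∎

  -- Transfer is phrased with preimages because membership in a preimage carries no existential
  -- witness.
  infix 8 _⁻¹[_]
  _⁻¹[_] : ∀ {d} → Matrix d → Subset d → Subset d
  (U ⁻¹[ P ]) x = f[ U ] x ∈ P

  convexHull-resp-≋ : ∀ {d k} (p : Fin k → Point d) → Respects≋ (ConvexHull p)
  convexHull-resp-≋ p x≋y (a , a≥0 , ∑a≈1 , x≋) = a , a≥0 , ∑a≈1 , ≋-trans (≋-sym x≋y) x≋

  latticePolytope-resp-≋ : ∀ {d} {P : Subset d} → LatticePolytope P → Respects≋ P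
  latticePolytope-resp-≋ (k , v , P⊆ , ⊆P) x≋y x∈P = ⊆P (convexHull-resp-≋ _ x≋y (P⊆ x∈P))

  preimage-sym : ∀ {d} {U V : Matrix d} {P P′ : Subset d} → MutuallyInverse U V → Respects≋ P′ →
                 P ≐ U ⁻¹[ P′ ] → P′ ≐ V ⁻¹[ P ]
  preimage-sym inv resp (P⊆ , ⊆P) =
    (λ x∈P′ → ⊆P (resp (≋-sym (f-inverse inv _)) x∈P′)) , (λ Vx∈P → resp (f-inverse inv _) (P⊆ Vx∈P))

  -- The generators are pulled back by `V`, whose integrality keeps them in the lattice.
  latticePolytope-preimage : ∀ {d} {U V : Matrix d} {P P′ : Subset d} → MutuallyInverse U V →
                             P ≐ U ⁻¹[ P′ ] → LatticePolytope P′ → LatticePolytope P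
  latticePolytope-preimage {U = U} {V} {P} inv (P⊆ , ⊆P) (k , v , P′⊆ , ⊆P′) =
    k , (λ j → v j ⊙ V) , forward , backward
    where
    forward : ∀ {x} → x ∈ P → x ∈ ConvexHull (λ j → embed (v j ⊙ V))
    forward {x} x∈P = let a , a≥0 , ∑a≈1 , Ux≋ = P′⊆ (P⊆ x∈P) in a , a≥0 , ∑a≈1 , λ i → begin
      x i                                            ≈⟨ f-inverse (mutuallyInverse-sym inv) x i ⟨
      f[ V ] (f[ U ] x) i                            ≈⟨ f-cong V Ux≋ i ⟩
      f[ V ] (combination a (embed ∘ v)) i           ≈⟨ f-combination V a (embed ∘ v) i ⟩
      combination a (λ j → f[ V ] (embed (v j))) i   ≈⟨ combination-cong a (λ j → f-embed V (v j)) i ⟩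
      combination a (λ j → embed (v j ⊙ V)) i        ∎
    backward : ∀ {x} → x ∈ ConvexHull (λ j → embed (v j ⊙ V)) → x ∈ P
    backward {x} (a , a≥0 , ∑a≈1 , x≋) = ⊆P (⊆P′ (a , a≥0 , ∑a≈1 , λ i → begin
      f[ U ] x i                                              ≈⟨ f-cong U x≋ i ⟩
      f[ U ] (combination a (λ j → embed (v j ⊙ V))) i        ≈⟨ f-combination U a _ i ⟩
      combination a (λ j → f[ U ] (embed (v j ⊙ V))) i
        ≈⟨ combination-cong a (λ j → ≋-trans (f-cong U (≋-sym (f-embed V (v j)))) (f-inverse inv _)) i ⟩
      combination a (embed ∘ v) i                             ∎))

  fullDimensional-preimage : ∀ {d} {U V : Matrix d} {P P′ : Subset d} → MutuallyInverse U V → Respects≋ P′ →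
                             P ≐ U ⁻¹[ P′ ] → FullDimensional P′ → FullDimensional P
  fullDimensional-preimage {U = U} {V} inv resp (P⊆ , ⊆P) full x =
    let k , p , a , p∈P′ , ∑a≈1 , Ux≋ = full (f[ U ] x) in k , (λ j → f[ V ] (p j)) , a ,
    (λ j → ⊆P (resp (≋-sym (f-inverse inv (p j))) (p∈P′ j))) , ∑a≈1 , λ i → begin
      x i                                  ≈⟨ f-inverse (mutuallyInverse-sym inv) x i ⟨
      f[ V ] (f[ U ] x) i                  ≈⟨ f-cong V Ux≋ i ⟩
      f[ V ] (combination a p) i           ≈⟨ f-combination V a p i ⟩
      combination a (λ j → f[ V ] (p j)) i ∎

  Close-resp : ∀ {ε x y z} → y ≈ z → Close ε x y → Close ε x z
  Close-resp y≈z = Close-cong (+-congˡ (-‿cong y≈z))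

  -- Continuity pulls a ball about `x′` back to a ball about `x`. The separate `x′` allows an
  -- embedded lattice point in place of `f[ U ] x`.
  interior-preimage : ∀ {d} (U : Matrix d) {P P′ : Subset d} → P ≐ U ⁻¹[ P′ ] →
                      ∀ {x x′} → f[ U ] x ≋ x′ → x′ ∈ Interior P′ → x ∈ Interior P
  interior-preimage U (P⊆ , ⊆P) {x} Ux≋x′ (ε , 0<ε , ball) = let η , 0<η , continuous = f-continuous U 0<ε in
    η , 0<η , λ y close →
    ⊆P (ball (f[ U ] y) λ j → Close-resp (Ux≋x′ j) (continuous x y close j))

  -- Interior lattice points z of `P` correspond to interior lattice points `z ⊙ U` of `P′`, and by
  -- injectivity `z ⊙ U` vanishes only with z.
  fano-preimage : ∀ {d} {U V : Matrix d} {P P′ : Subset d} → MutuallyInverse U V →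
                  P ≐ U ⁻¹[ P′ ] → Fano P′ → Fano P
  fano-preimage {U = U} {V} {P} {P′} inv P≐ (lattice , full , interior) =
    latticePolytope-preimage inv P≐ lattice ,
    fullDimensional-preimage inv resp P≐ full ,
    λ z → mk⇔
      (λ z∈P → left-inverse⇒injective U V (MutuallyInverse.left inv) z (Equivalence.to (interior (z ⊙ U))
        (interior-preimage V (preimage-sym inv resp P≐)
          (≋-trans (f-cong V (≋-sym (f-embed U z))) (f-inverse (mutuallyInverse-sym inv) _)) z∈P)))
      (λ z≡0 → interior-preimage U P≐ (f-embed U z) (Equivalence.from (interior (z ⊙ U)) λ j → zero-⊙ z z≡0 j))
    where
    open RingSums ℤₚ.+-*-commutativeRing using () renaming (sum-zero to ℤ-sum-zero)
    resp : Respects≋ P′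
    resp = latticePolytope-resp-≋ lattice
    zero-⊙ : ∀ z → (∀ i → z i ≡ 0ℤ) → ∀ j → (z ⊙ U) j ≡ 0ℤ
    zero-⊙ z z≡0 j = ℤ-sum-zero _ (λ i → ≡.cong (ℤ._* U i j) (z≡0 i))

  -- The dual transforms by the inverse transpose: pairing qV with y equals pairing q with y times
  -- the transpose of `V`.
  dual-preimage : ∀ {d} {U V : Matrix d} {P P′ : Subset d} → MutuallyInverse U V → Respects≋ P′ →
                  P ≐ U ⁻¹[ P′ ] → Dual P ≐ (λ i j → V j i) ⁻¹[ Dual P′ ]
  dual-preimage {U = U} {V} inv resp (P⊆ , ⊆P) =
    (λ {y} y∈ q q∈P′ → ≤-resp-≈ (f-adjoint V q y) refl
      (y∈ (f[ V ] q) (⊆P (resp (≋-sym (f-inverse inv q)) q∈P′)))) ,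
    (λ {y} y∈ x x∈P → ≤-resp-≈
      (trans (sym (f-adjoint V (f[ U ] x) y)) (⟨⟩-congˡ (f-inverse (mutuallyInverse-sym inv) x) y)) refl
      (y∈ (f[ U ] x) (P⊆ x∈P)))

  reflexive-preimage : ∀ {d} {U V : Matrix d} {P P′ : Subset d} → MutuallyInverse U V →
                       P ≐ U ⁻¹[ P′ ] → Reflexive P′ → Reflexive P
  reflexive-preimage {U = U} {V} inv P≐ (fano , dual) =
    fano-preimage inv P≐ fano ,
    latticePolytope-preimage (mutuallyInverse-transpose inv)
      (dual-preimage inv (latticePolytope-resp-≋ (proj₁ fano)) P≐) dual

  -- This is transfer along the identity matrix, whose map is the identity up to `≋`.
  reflexive-resp-≐ : ∀ {d} {P P′ : Subset d} → P ≐ P′ → Reflexive P′ → Reflexive P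
  reflexive-resp-≐ (P⊆ , ⊆P) r@((lattice , _) , _) = reflexive-preimage mutuallyInverse-δ
    ((λ {x} x∈P → resp (≋-sym (f-δ x)) (P⊆ x∈P)) , (λ {x} δx∈P′ → ⊆P (resp (f-δ x) δx∈P′))) r
    where resp = latticePolytope-resp-≋ lattice

  -- Translates and the reduction of the Gorenstein property

  translate-cong : ∀ {d} {P P′ : Subset d} w → P ≐ P′ → translate P w ≐ translate P′ w
  translate-cong w (P⊆ , ⊆P) = (λ (x , x∈ , y≋) → x , P⊆ x∈ , y≋) , (λ (x , x∈ , y≋) → x , ⊆P x∈ , y≋)

  reflexiveUpToTranslation-resp-≐ : ∀ {d} {P P′ : Subset d} → P ≐ P′ →
    ReflexiveUpToTranslation P′ → ReflexiveUpToTranslation P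
  reflexiveUpToTranslation-resp-≐ P≐P′ (w , r) = w , reflexive-resp-≐ (translate-cong w P≐P′) r

  -- Since pU + w = (p + wV)U, pulling `Q` back along `U` changes the translation vector from w to
  -- wV.
  unimodularlyEquivalent⇒reflexive : ∀ {d} {U V : Matrix d} {P Q : Subset d} w → MutuallyInverse U V →
    Q ≐ translate (image f[ U ] P) w → Reflexive Q → Reflexive (translate P (w ⊙ V))
  unimodularlyEquivalent⇒reflexive {U = U} {V} {P} {Q} w inv (Q⊆ , ⊆Q) = reflexive-preimage inv (forward , backward)
    where
    forward : ∀ {x} → x ∈ translate P (w ⊙ V) → f[ U ] x ∈ Q
    forward {x} (p , p∈ , x≋) = ⊆Q (f[ U ] p , (p , p∈ , λ i → refl) , λ i → begin
      f[ U ] x i                                   ≈⟨ f-cong U x≋ i ⟩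
      f[ U ] (p ⊕ embed (w ⊙ V)) i                 ≈⟨ f-⊕ U p _ i ⟩
      f[ U ] p i + f[ U ] (embed (w ⊙ V)) i        ≈⟨ +-congˡ (f-cong U (≋-sym (f-embed V w)) i) ⟩
      f[ U ] p i + f[ U ] (f[ V ] (embed w)) i     ≈⟨ +-congˡ (f-inverse inv (embed w) i) ⟩
      f[ U ] p i + embed w i                       ∎)
    backward : ∀ {x} → f[ U ] x ∈ Q → x ∈ translate P (w ⊙ V)
    backward {x} Ux∈Q = let y , (p , p∈ , y≋) , Ux≋ = Q⊆ Ux∈Q in p , p∈ , λ i → begin
      x i                                          ≈⟨ f-inverse (mutuallyInverse-sym inv) x i ⟨
      f[ V ] (f[ U ] x) i                          ≈⟨ f-cong V Ux≋ i ⟩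
      f[ V ] (y ⊕ embed w) i                       ≈⟨ f-⊕ V y _ i ⟩
      f[ V ] y i + f[ V ] (embed w) i              ≈⟨ +-cong (f-cong V y≋ i) (f-embed V w i) ⟩
      f[ V ] (f[ U ] p) i + embed (w ⊙ V) i        ≈⟨ +-congʳ (f-inverse (mutuallyInverse-sym inv) p i) ⟩
      p i + embed (w ⊙ V) i                        ∎

  gorenstein⇒reflexive : ∀ {d} c {P : Subset d} → Gorenstein c P → ReflexiveUpToTranslation (dilate c P)
  gorenstein⇒reflexive c (_ , Q , r , U , w , detU , Q≐) =
    let V , inv = unimodular⇒inverse U detU in w ⊙ V , unimodularlyEquivalent⇒reflexive w inv Q≐ r

  reflexive⇒gorenstein : ∀ {d} c .{{_ : NonZero c}} {P : Subset d} →
                         ReflexiveUpToTranslation (dilate c P) → Gorenstein c P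
  reflexive⇒gorenstein {d} c@(suc _) {P} (w , r) = _ , translate (dilate c P) w , r , δ , w , inj₁ (det-δ d) ,
    translate-cong w
      ( (λ {x} x∈ → x , x∈ , ≋-sym (f-δ x))
      , (λ {y} (x , (p , p∈ , x≋) , y≋) → p , p∈ , ≋-trans y≋ (≋-trans (f-δ x) x≋)))

  -- A ball about z shifts to one about z + w inside the Fano translate, which leaves - w as the
  -- only candidate for z.
  fano-interior-unique : ∀ {d} {P : Subset d} w → Fano (translate P w) → ∀ z → embed z ∈ Interior P →
                         ∀ i → z i ℤ.+ w i ≡ 0ℤ
  fano-interior-unique w (_ , _ , interior) z (ε , 0<ε , ball) =
    Equivalence.to (interior (λ i → z i ℤ.+ w i)) (ε , 0<ε , λ y close →
      (λ i → y i - embed w i) ,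
      ball _ (λ i → Close-cong (trans (+-congˡ (-‿cong (fromℤ-+ (z i) (w i))))
        (solve 3 (λ y z w → y :- (z :+ w) := (y :- w) :- z) refl (y i) (embed z i) (embed w i))) (close i)) ,
      λ i → solve 2 (λ y w → y := (y :- w) :+ w) refl (y i) (embed w i))

  -- Dilations and interior lattice points of lecture hall polytopes

  -- Membership depends only on the ratios x_i / s_i, which survive scaling both x and s by c.
  dilate-lectureHall : ∀ {n} c .{{_ : NonZero c}} (s t : Vector ℕ (suc n)) s⁺ t⁺ → (∀ i → c ℕ.* s i ≡ t i) →
                       dilate c (LectureHall s s⁺) ≐ LectureHall t t⁺
  dilate-lectureHall {n} c s t s⁺ t⁺ cs≡t =
    (λ {y} (x , x∈ , y≋) → transport s⁺ t⁺ {x} {y} (λ i → sym (scale {x} {y} y≋ i)) x∈) ,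
    (λ {y} y∈ → let y/c = λ i → y i ÷ c
                    y≋ = λ i → sym (fromℕ÷ c (y i))
                in y/c , transport t⁺ s⁺ {y} {y/c} (scale {y/c} {y} y≋) y∈ , y≋)
    where
    scale : ∀ {x y} → y ≋ (λ i → fromℕ# c * x i) → ∀ i → _÷_ (y i) (t i) {{t⁺ i}} ≈ _÷_ (x i) (s i) {{s⁺ i}}
    scale {x} {y} y≋ i = trans (*-congʳ (y≋ i)) (÷-scale c (s i) (t i) {{s⁺ i}} {{t⁺ i}} (cs≡t i) (x i))
    transport : ∀ {s t : Vector ℕ (suc n)} (s⁺ : Positive s) (t⁺ : Positive t) {x y : Point (suc n)} →
      (∀ i → _÷_ (x i) (s i) {{s⁺ i}} ≈ _÷_ (y i) (t i) {{t⁺ i}}) → x ∈ LectureHall s s⁺ → y ∈ LectureHall t t⁺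
    transport _ _ eq (low , mid , high) = ≤-resp-≈ refl (eq zero) low ,
      (λ i → ≤-resp-≈ (eq (inject₁ i)) (eq (suc i)) (mid i)) , ≤-resp-≈ (eq (fromℕ n)) refl high

  -- The hypotheses are the defining inequalities at z, strict and cleared of denominators. Between
  -- integers each has slack at least 1, and the radius is chosen to use up less than that.
  interior-lectureHall : ∀ {n} (t : Vector ℕ (suc n)) t⁺ (z : Vector ℕ (suc n)) → 0 ℕ.< z zero →
    (∀ i → z (inject₁ i) ℕ.* t (suc i) ℕ.< z (suc i) ℕ.* t (inject₁ i)) → z (fromℕ n) ℕ.< t (fromℕ n) →
    embed (λ i → + z i) ∈ Interior (LectureHall t t⁺)
  interior-lectureHall {n} t t⁺ z low mid high = 1/ M , 0<1/ M , λ y close →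
    <⇒≤ (<-respˡ-≈ (zeroˡ _) (÷-monoˡ-< (t zero) {{t⁺ zero}} (y₀>0 y close))) ,
    (λ i → <⇒≤ (crossDivide (t (inject₁ i)) (t (suc i)) {{t⁺ (inject₁ i)}} {{t⁺ (suc i)}} (y-mid y close i))) ,
    <⇒≤ (<-respʳ-≈ (fromℕ*1/ (t (fromℕ n)) {{t⁺ (fromℕ n)}})
      (÷-monoˡ-< (t (fromℕ n)) {{t⁺ (fromℕ n)}} (yₙ<tₙ y close)))
    where
    -- Moving coordinates by less than 1 / M costs a cross-multiplied inequality less than (t_i +
    -- t_(i+1)) / M, and twice the total exceeds any such numerator or equals it. The first `suc`
    -- makes the bound strict, the second ensures 1 < M and hence ε < 1.
    M = suc (suc (total t ℕ.+ total t))
    ε = 1/ M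
    ε*< : ∀ {a} → a ℕ.< M → fromℕ# a * ε < 1#
    ε*< a<M = <-respʳ-≈ (fromℕ*1/ M) (*-monoʳ-< (0<1/ M) (fromℕ-mono-< a<M))
    ε<1 : ε < 1#
    ε<1 = <-respˡ-≈ (trans (*-congʳ (+-identityʳ 1#)) (*-identityˡ ε)) (ε*< (ℕ.s≤s (ℕ.s≤s ℕ.z≤n)))
    crossDivide : ∀ {x y} a b .{{_ : NonZero a}} .{{_ : NonZero b}} → x * fromℕ# b < y * fromℕ# a → x ÷ a < y ÷ b
    crossDivide {x} {y} a b xb<ya = <-resp₂-≈ (cancel x a b)
      (trans (*-congˡ (*-comm _ _)) (cancel y b a)) (*-monoʳ-< (*-pos (0<1/ a) (0<1/ b)) xb<ya)
      where
      cancel : ∀ x a b .{{_ : NonZero a}} .{{_ : NonZero b}} → x * fromℕ# b * (1/ a * 1/ b) ≈ x ÷ a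
      cancel x a b = begin
        x * fromℕ# b * (1/ a * 1/ b)
          ≈⟨ solve 4 (λ x b p q → x :* b :* (p :* q) := x :* p :* (b :* q)) refl x (fromℕ# b) (1/ a) (1/ b) ⟩
        x * 1/ a * (fromℕ# b * 1/ b)  ≈⟨ *-congˡ (fromℕ*1/ b) ⟩
        x * 1/ a * 1#                 ≈⟨ *-identityʳ _ ⟩
        x * 1/ a                      ∎
    module _ (y : Point (suc n)) (close : ∀ i → Close ε (y i) (fromℕ# (z i))) where
      y<z+ε : ∀ i → y i < fromℕ# (z i) + ε
      y<z+ε i = <-resp₂-≈ (solve 2 (λ y z → z :+ (y :- z) := y) refl (y i) (fromℕ# (z i))) refl
        (+-monoʳ-< (fromℕ# (z i)) (proj₁ (close i)))
      z<y+ε : ∀ i → fromℕ# (z i) < y i + ε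
      z<y+ε i = <-resp₂-≈ (solve 2 (λ y z → y :+ (z :- y) := z) refl (y i) (fromℕ# (z i))) refl
        (+-monoʳ-< (y i) (proj₂ (close i)))
      y₀>0 : 0# < y zero
      y₀>0 = +-cancelʳ-< ε (<-trans (fromℕ-+-< ε<1 low) (z<y+ε zero))
      yₙ<tₙ : y (fromℕ n) < fromℕ# (t (fromℕ n))
      yₙ<tₙ = <-trans (y<z+ε (fromℕ n)) (fromℕ-+-< ε<1 high)
      y-mid : ∀ i → y (inject₁ i) * fromℕ# (t (suc i)) < y (suc i) * fromℕ# (t (inject₁ i))
      -- Both errors are gathered on the left: with z, z′ and y, y′ the neighbouring coordinates, y
      -- b + a ε < z b + (a + b) ε < z′ a < y′ a + a ε.
      y-mid i = +-cancelʳ-< (fromℕ# a * ε) (<-trans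
        (<-respʳ-≈ left (+-monoˡ-< (fromℕ# a * ε) (*-monoʳ-< (0<fromℕ b {{t⁺ (suc i)}}) (y<z+ε (inject₁ i)))))
        (<-trans (fromℕ-+-< (ε*< a+b<M) (mid i))
          (<-resp₂-≈ (sym (fromℕ-* (z (suc i)) a)) (trans (distribʳ _ _ _) (+-congˡ (*-comm _ _)))
            (*-monoʳ-< (0<fromℕ a {{t⁺ (inject₁ i)}}) (z<y+ε (suc i))))))
        where
        a = t (inject₁ i)
        b = t (suc i)
        a+b<M : a ℕ.+ b ℕ.< M
        a+b<M = ℕ.s≤s (ℕₚ.m≤n⇒m≤1+n (ℕₚ.+-mono-≤ (≤-total t (inject₁ i)) (≤-total t (suc i))))
        left : (fromℕ# (z (inject₁ i)) + ε) * fromℕ# b + fromℕ# a * ε ≈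
               fromℕ# (z (inject₁ i) ℕ.* b) + fromℕ# (a ℕ.+ b) * ε
        left = begin
          (fromℕ# (z (inject₁ i)) + ε) * fromℕ# b + fromℕ# a * ε
            ≈⟨ solve 4 (λ z ε b a → (z :+ ε) :* b :+ a :* ε := z :* b :+ (a :+ b) :* ε) refl
                 (fromℕ# (z (inject₁ i))) ε (fromℕ# b) (fromℕ# a) ⟩
          fromℕ# (z (inject₁ i)) * fromℕ# b + (fromℕ# a + fromℕ# b) * ε
            ≈⟨ +-cong (fromℕ-* (z (inject₁ i)) b) (*-congʳ (fromℤ-+ (+ a) (+ b))) ⟨
          fromℕ# (z (inject₁ i) ℕ.* b) + fromℕ# (a ℕ.+ b) * ε ∎

  interior-lectureHall-∸ : ∀ {n} (t : Vector ℕ (suc n)) t⁺ → StrictlyIncreasing t →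
    ∀ k .{{_ : NonZero k}} → (∀ i → k ℕ.< t i) → embed (λ i → + (t i ℕ.∸ k)) ∈ Interior (LectureHall t t⁺)
  interior-lectureHall-∸ {n} t t⁺ t↑ k k<t = interior-lectureHall t t⁺ (λ i → t i ℕ.∸ k)
    (ℕₚ.m<n⇒0<n∸m (k<t zero))
    (λ i → ∸-cross (ℕₚ.<⇒≤ (k<t (inject₁ i))) (t↑ (inject₁ i) (suc i) (ℕₚ.≤-reflexive (≡.cong suc (toℕ-inject₁ i)))))
    (ℕₚ.∸-monoʳ-< {o = 0} (ℕ.>-nonZero⁻¹ k) (ℕₚ.<⇒≤ (k<t (fromℕ n))))
    where
    -- Both sides are ab less a multiple of k, and the left loses kb, more than ka. By k ≤ a this
    -- stays within ab, so truncated subtraction is still strict.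
    ∸-cross : ∀ {a b} → k ℕ.≤ a → a ℕ.< b → (a ℕ.∸ k) ℕ.* b ℕ.< (b ℕ.∸ k) ℕ.* a
    ∸-cross {a} {b} k≤a a<b = ≡.subst₂ ℕ._<_ (≡.sym (ℕₚ.*-distribʳ-∸ b a k))
      (≡.trans (≡.cong (ℕ._∸ k ℕ.* a) (ℕₚ.*-comm a b)) (≡.sym (ℕₚ.*-distribʳ-∸ a b k)))
      (ℕₚ.∸-monoʳ-< (ℕₚ.*-monoʳ-< k a<b) (ℕₚ.*-monoˡ-≤ b k≤a))

  -- Both t - 1 and t - 2 would have to equal - w; coordinate `zero` already tells them apart.
  fano-lectureHall : ∀ {n} (t : Vector ℕ (suc n)) t⁺ → StrictlyIncreasing t → (∀ i → 2 ℕ.< t i) →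
                     ∀ w → ¬ Fano (translate (LectureHall t t⁺) w)
  fano-lectureHall t t⁺ t↑ 2<t w fano = ℕₚ.<⇒≢ (ℕₚ.∸-monoʳ-< {t zero} (ℕₚ.n<1+n 1) (ℕₚ.<⇒≤ (2<t zero)))
    (ℤₚ.+-injective (ℤ-+-cancelʳ (w zero) _ _ (≡.trans (sumZero 2 2<t) (≡.sym (sumZero 1 (ℕₚ.<⇒≤ ∘ 2<t))))))
    where
    sumZero : ∀ k .{{_ : NonZero k}} → (∀ i → k ℕ.< t i) → + (t zero ℕ.∸ k) ℤ.+ w zero ≡ 0ℤ
    sumZero k k<t = fano-interior-unique w fano (λ i → + (t i ℕ.∸ k)) (interior-lectureHall-∸ t t⁺ t↑ k k<t) zero

-- Characterisation of index 2 and exclusion of larger indices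

open import Data.Nat using (_*_; _≤_)

corollary2p4 : ∀ {ℓ : Level} (ℝ : RealNumbers ℓ) (n : ℕ) →
    let open Polytopes (RealNumbers.orderedField ℝ) in
    ((s : Vector ℕ (suc n)) (s⁺ : Positive s) → StrictlyIncreasing s →
    Gorenstein 2 (LectureHall s s⁺) ⇔
    (Σ (Vector ℕ (suc n)) λ t → Σ (Positive t) λ t⁺ →
    (∀ i → 2 * s i ≡ t i) × ReflexiveUpToTranslation (LectureHall t t⁺)))
    ×
    ((c : ℕ) → 3 ≤ c →
    ¬ (Σ (Vector ℕ (suc n)) λ s → Σ (Positive s) λ s⁺ →
    StrictlyIncreasing s × Gorenstein c (LectureHall s s⁺)))
corollary2p4 ℝ n = indexTwo , noHigherIndex
  where
  open Polytopes (RealNumbers.orderedField ℝ)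
  open LatticeTransformations (RealNumbers.orderedField ℝ)

  dilation⁺ : ∀ c .{{_ : NonZero c}} (s : Vector ℕ (suc n)) → Positive s → Positive (λ i → c * s i)
  dilation⁺ c {{c⁺}} s s⁺ i = ℕₚ.m*n≢0 c (s i) {{c⁺}} {{s⁺ i}}

  reflexiveDilation : ∀ c .{{_ : NonZero c}} s s⁺ → Gorenstein c (LectureHall {n} s s⁺) →
    ReflexiveUpToTranslation (LectureHall (λ i → c * s i) (dilation⁺ c s s⁺))
  reflexiveDilation c s s⁺ gorenstein = reflexiveUpToTranslation-resp-≐
    (swap (dilate-lectureHall c s (λ i → c * s i) s⁺ (dilation⁺ c s s⁺) λ i → ≡.refl))
    (gorenstein⇒reflexive c gorenstein)

  indexTwo : (s : Vector ℕ (suc n)) (s⁺ : Positive s) → StrictlyIncreasing s →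
    Gorenstein 2 (LectureHall s s⁺) ⇔
    (Σ (Vector ℕ (suc n)) λ t → Σ (Positive t) λ t⁺ →
      (∀ i → 2 * s i ≡ t i) × ReflexiveUpToTranslation (LectureHall t t⁺))
  indexTwo s s⁺ _ = mk⇔
    (λ gorenstein → (λ i → 2 * s i) , dilation⁺ 2 s s⁺ , (λ i → ≡.refl) , reflexiveDilation 2 s s⁺ gorenstein)
    (λ (t , t⁺ , 2s≡t , reflexive) → reflexive⇒gorenstein 2
      (reflexiveUpToTranslation-resp-≐ (dilate-lectureHall 2 s t s⁺ t⁺ 2s≡t) reflexive))

  noHigherIndex : (c : ℕ) → 3 ≤ c → ¬ (Σ (Vector ℕ (suc n)) λ s → Σ (Positive s) λ s⁺ →
    StrictlyIncreasing s × Gorenstein c (LectureHall s s⁺))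
  noHigherIndex c@(suc _) 3≤c (s , s⁺ , s↑ , gorenstein) =
    let w , fano , _ = reflexiveDilation c s s⁺ gorenstein in
    fano-lectureHall (λ i → c * s i) (dilation⁺ c s s⁺) (λ i j i<j → ℕₚ.*-monoʳ-< c (s↑ i j i<j))
      -- The required 2 < c s_i unfolds to 3 ≤ c s_i, which is where c ≥ 3 enters.
      (λ i → ℕₚ.≤-trans 3≤c (ℕₚ.m≤m*n c (s i) {{s⁺ i}})) w fano
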